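{- Let $n$ be a positive multiple of $3$, let $\Pi$ be a $3$-decomposable halfperiod on $n$ points, and let $k$ be a positive integer with $k<n/2$. Then $N_{\le k}(\Pi)\geq B(k,n)$, where \[ B(k,n):=3\binom{k+1}{2}+3\binom{k+1-n/3}{2}+3\sum_{j=2}^{s-1}j(j+1)\binom{k+1-c_j n}{2}, \] $c_j:=\frac12-\frac{1}{3j(j+1)}$, and $s$ is the unique integer with $\binom{s}{2}<\frac{n}{3(n-2k-1)}\leq\binom{s+1}{2}$.
   Context: For real $r$, $\binom{r}{2}:=\frac{r(r-1)}{2}$ if $r\ge 2$ and $0$ if $r<2$. A halfperiod on $n$ points is a sequence $\Pi=(\pi_0,\pi_1,\dots,\pi_{\binom n2})$ of permutations (orderings) of an $n$-element set such that each $\pi_{i+1}$ is obtained from $\pi_i$ by transposing two elements in adjacent positions, and $\pi_{\binom n2}$ is the reverse of $\pi_0$ (so every pair of elements is transposed exactly once). A transposition between the elements in positions $i$ and $i+1$ is an $i$-transposition. For $i\le n/2$, an $i$-critical transposition is an $i$-transposition or an $(n-i)$-transposition; a $(\le k)$-critical transposition is one that is $i$-critical for some $i\le k$. $N_{\le k}(\Pi)$ is the number of $(\le k)$-critical transpositions in $\Pi$. $\Pi$ is $3$-decomposable if its elements can be labeled $A=\{a_1,\dots,a_{n/3}\}$, $B=\{b_1,\dots,b_{n/3}\}$, $C=\{c_1,\dots,c_{n/3}\}$ so that $\pi_0=(a_1,\dots,a_{n/3},b_1,\dots,b_{n/3},c_1,\dots,c_{n/3})$ and for some indices $0<s<t\le\binom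 n2$, $\pi_{s+1}$ shows all elements of $B$, followed by all elements of $A$, followed by all elements of $C$, and $\pi_{t+1}$ shows all elements of $B$, followed by all elements of $C$, followed by all elements of $A$. -}

module Defs where

open import Data.Nat as ℕ using (ℕ; zero; suc; _+_; _*_; _∸_; _≤_; _<_; _≤?_)
open import Data.Nat.Combinatorics using (_C_)
open import Data.Fin using (Fin)
open import Data.List using (List; []; _∷_; reverse; take; drop; length; filter; upTo)
open import Data.List.Relation.Binary.Permutation.Propositional using (_↭_)
open import Data.List using (allFin)
open import Data.Integer using (+_)
open import Data.Rational as ℚ using (ℚ; 0ℚ; 1ℚ; _≤ᵇ_)
open import Data.Product using (_×_; Σ; ∃)
open import Data.Sum using (_⊎_)
open import Data.Bool using (if_then_else_)
open import Relation.Binary.PropositionalEquality using (_≡_)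
open import Relation.Nullary.Decidable using (_⊎-dec_)

-- An ordering (permutation) of the n points (here: Fin n) is a list listing
-- every point exactly once, i.e. a permutation of allFin n.
Ordering : ℕ → Set
Ordering n = List (Fin n)

swapAt : {A : Set} → ℕ → List A → List A
swapAt zero    (x ∷ y ∷ xs) = y ∷ x ∷ xs
swapAt (suc p) (x ∷ xs)     = x ∷ swapAt p xs
swapAt _       xs           = xs

-- An i-transposition (1-indexed: positions i and i+1) applied to an ordering.
iTransp : {A : Set} → ℕ → List A → List A
iTransp i = swapAt (i ∸ 1)

orderAt : {A : Set} → List A → (ℕ → ℕ) → ℕ → List A
orderAt π₀ τ zero    = π₀
orderAt π₀ τ (suc t) = iTransp (τ t) (orderAt π₀ τ t)

record Halfperiod (n : ℕ) : Set where
  field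
    π₀       : Ordering n
    π₀-perm  : π₀ ↭ allFin n
    τ        : ℕ → ℕ
    τ-range  : ∀ t → t < n C 2 → 1 ≤ τ t × τ t < n
    reversed : orderAt π₀ τ (n C 2) ≡ reverse π₀

  π : ℕ → Ordering n
  π = orderAt π₀ τ

-- A transposition of index j (an j-transposition) is (≤ k)-critical iff it is
-- an i- or (n-i)-transposition for some 1 ≤ i ≤ k (for k < n/2),
-- i.e. j ≤ k or n - j ≤ k.
LeCritical : ℕ → ℕ → ℕ → Set
LeCritical n k j = j ≤ k ⊎ n ≤ j + k

leCritical? : ∀ n k j → Relation.Nullary.Decidable.Dec (LeCritical n k j)
leCritical? n k j = (j ≤? k) ⊎-dec (n ≤? j + k)
  where import Relation.Nullary.Decidable

N≤ : ∀ {n} → ℕ → Halfperiod n → ℕ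
N≤ {n} k Π = length (filter (λ t → leCritical? n k (Halfperiod.τ Π t)) (upTo (n C 2)))

-- Π on n = 3m points is 3-decomposable: with A, B, C the first, middle and
-- last m elements of π_0, there are 0 < s < t with t+1 ≤ C(n,2) such that
-- π_{s+1} lists B, then A, then C, and π_{t+1} lists B, then C, then A.
-- (A block of an ordering is compared as a set, via ↭, since the elements
-- are distinct.)
ThreeDecomposable : (m : ℕ) → Halfperiod (3 * m) → Set
ThreeDecomposable m Π =
  Σ ℕ λ s → Σ ℕ λ t →
    0 < s × s < t × t + 1 ≤ (3 * m) C 2 ×
    (take m (π (suc s)) ↭ blkB × take m (drop m (π (suc s))) ↭ blkA × drop (2 * m) (π (suc s)) ↭ blkC) ×
    (take m (π (suc t)) ↭ blkB × take m (drop m (π (suc t))) ↭ blkC × drop (2 * m) (π (suc t)) ↭ blkA)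
  where
  open Halfperiod Π
  blkA = take m π₀
  blkB = take m (drop m π₀)
  blkC = drop (2 * m) π₀

ℕtoℚ : ℕ → ℚ
ℕtoℚ n = + n ℚ./ 1

binomQ : ℚ → ℚ
binomQ r = if (ℕtoℚ 2 ≤ᵇ r) then (r ℚ.* (r ℚ.- 1ℚ)) ℚ.* ℚ.½ else 0ℚ

-- c_j n = n/2 - n/(3 j (j+1)), for j = i + 2 ≥ 2.
cTimesN : ℕ → ℕ → ℚ
cTimesN i n = (+ n ℚ./ 2) ℚ.- (+ n ℚ./ (3 * (2 + i) * (3 + i)))

term : ℕ → ℕ → ℕ → ℚ
term k n i = ℕtoℚ ((2 + i) * (3 + i)) ℚ.* binomQ (ℕtoℚ (k + 1) ℚ.- cTimesN i n)

-- Σ_{j=2}^{s-1} j(j+1) binom(k+1-c_j n, 2)  =  Σ_{i=0}^{s-3} term k n i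
sumTerms : ℕ → ℕ → ℕ → ℚ
sumTerms k n zero    = 0ℚ
sumTerms k n (suc c) = sumTerms k n c ℚ.+ term k n c

Bound : ℕ → ℕ → ℕ → ℚ
Bound k n s =
  ℕtoℚ 3 ℚ.* binomQ (ℕtoℚ (k + 1))
  ℚ.+ ℕtoℚ 3 ℚ.* binomQ (ℕtoℚ (k + 1) ℚ.- ℕtoℚ (n ℕ./ 3))
  ℚ.+ ℕtoℚ 3 ℚ.* sumTerms k n (s ∸ 2)

-- s is the integer with C(s,2) < n / (3(n-2k-1)) ≤ C(s+1,2)
-- (cleared of the denominator).
IsS : ℕ → ℕ → ℕ → Set
IsS k n s = (s C 2) * (3 * (n ∸ (2 * k + 1))) < n × n ≤ (suc s C 2) * (3 * (n ∸ (2 * k + 1)))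

{-# OPTIONS --safe #-}
module Submission where

-- Only the ≤ k-critical swaps are wanted, so bound the number of central ones, those
-- in positions k + 1, …, n - k - 1; let d = n - 2k - 1 be the number of these positions.
-- C(n,2) swaps reverse π₀ only if each pair is swapped exactly once. Fix a time T and
-- orient every central swap from the element that is ahead at time T to the other one.
-- An element among the first k at time T crosses the centre once going forward from T
-- and once going backward, which gives out-degree = d + in-degree. At T = 0, t + 1 and
-- C(n,2) the first min(m,k) elements belong to A, B and C, so these three sets are
-- disjoint; summing degrees bounds the number of central swaps by the numbers of edges
-- inside the three sets. Cutting such an ordered digraph after p of its q vertices
-- gives e(q) ≤ e(p) + d p + C(q - p, 2), and iterating with nearly optimal cuts, i.e.
-- r + 1 blocks whose sizes grow by d, yields the sum in the bound, r being the number
-- of j ≥ 1 whose binomial coefficient does not vanish.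

open import Defs
open import Data.Nat using (ℕ; zero; suc; _+_; _*_; _∸_; _⊓_; _/_; _%_; _≤_; _<_; _<ᵇ_; _≡ᵇ_; z≤n; s≤s; z<s; s<s; s≤s⁻¹; s<s⁻¹; NonZero)
open import Data.Nat.Properties
open import Data.Nat.Combinatorics using (_C_; nC1≡n; nCk+nC[k+1]≡[n+1]C[k+1])
open import Data.Nat.Coprimality using (1-coprimeTo) renaming (sym to coprime-sym)
open import Data.Nat.DivMod using (m≡m%n+[m/n]*n; m%n<n; m*n/n≡m)
import Data.Nat.Tactic.RingSolver as ℕ-Ring
open import Data.Rational using () renaming (_≤_ to _≤ℚ_)
open import Data.Bool using (Bool; true; false; T)
open import Data.Fin using (Fin)
open import Data.List using (List; []; _∷_; _++_; reverse; take; drop; length; filter; applyUpTo)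
open import Data.List.Properties using (unfold-reverse; length-reverse; length-tabulate)
open import Data.List.Membership.Propositional using (_∈_)
open import Data.List.Relation.Unary.All using (lookup)
open import Data.List.Relation.Unary.Any using (here; there)
open import Data.List.Relation.Unary.AllPairs using (_∷_)
open import Data.List.Relation.Unary.Unique.Propositional using (Unique)
open import Data.List.Relation.Unary.Unique.Propositional.Properties using (allFin⁺)
open import Data.List.Relation.Binary.Permutation.Propositional using (_↭_; ↭-sym; ↭⇒↭ₛ)
open import Data.List.Relation.Binary.Permutation.Propositional.Properties using (↭-reverse; ↭-length; ∈-resp-↭)
import Data.List.Relation.Binary.Permutation.Setoid.Properties as Permutationₛ
open import Data.Product using (_×_; _,_; proj₁; proj₂; ∃)
open import Data.Sum using (_⊎_; inj₁; inj₂)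
open import Data.Empty using (⊥-elim)
open import Function using (_∘_; id)
open import Relation.Nullary using (¬_; Dec; yes; no; does)
open import Relation.Unary using (Decidable)
open import Relation.Binary.PropositionalEquality using (_≡_; refl; sym; trans; cong; cong₂; subst; subst₂; setoid; module ≡-Reasoning)
import Relation.Binary.Reasoning.Setoid as SetoidReasoning
open import Tactic.RingSolver using (solve-∀)
open import Tactic.RingSolver.Core.AlmostCommutativeRing using (AlmostCommutativeRing; fromCommutativeRing)
open import Data.Maybe using (nothing)

-- Finite sums and indicators

∑ : ℕ → (ℕ → ℕ) → ℕ
∑ zero    f = 0
∑ (suc n) f = f 0 + ∑ n (f ∘ suc)

∑-cong : ∀ n {f g} → (∀ i → i < n → f i ≡ g i) → ∑ n f ≡ ∑ n g
∑-cong zero    h = refl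
∑-cong (suc n) h = cong₂ _+_ (h 0 z<s) (∑-cong n (λ i i<n → h (suc i) (s<s i<n)))

∑-mono : ∀ n {f g} → (∀ i → i < n → f i ≤ g i) → ∑ n f ≤ ∑ n g
∑-mono zero    h = z≤n
∑-mono (suc n) h = +-mono-≤ (h 0 z<s) (∑-mono n (λ i i<n → h (suc i) (s<s i<n)))

∑-+ : ∀ n f g → ∑ n (λ i → f i + g i) ≡ ∑ n f + ∑ n g
∑-+ zero    f g = refl
∑-+ (suc n) f g rewrite ∑-+ n (f ∘ suc) (g ∘ suc) = +-interchange (f 0) (g 0) _ _
  where
  +-interchange : ∀ a b c d → a + b + (c + d) ≡ a + c + (b + d)
  +-interchange = ℕ-Ring.solve-∀

∑-*ˡ : ∀ n c f → ∑ n (λ i → c * f i) ≡ c * ∑ n f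
∑-*ˡ zero    c f = sym (*-zeroʳ c)
∑-*ˡ (suc n) c f rewrite ∑-*ˡ n c (f ∘ suc) = sym (*-distribˡ-+ c (f 0) _)

∑-*ʳ : ∀ n c f → ∑ n (λ i → f i * c) ≡ ∑ n f * c
∑-*ʳ zero    c f = refl
∑-*ʳ (suc n) c f rewrite ∑-*ʳ n c (f ∘ suc) = sym (*-distribʳ-+ c (f 0) _)

∑-const : ∀ n c → ∑ n (λ _ → c) ≡ n * c
∑-const zero    c = refl
∑-const (suc n) c = cong (c +_) (∑-const n c)

∑-zero : ∀ n {f} → (∀ i → i < n → f i ≡ 0) → ∑ n f ≡ 0
∑-zero n h = trans (∑-cong n h) (trans (∑-const n 0) (*-zeroʳ n))

∑-split : ∀ a b f → ∑ (a + b) f ≡ ∑ a f + ∑ b (λ i → f (a + i))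
∑-split zero    b f = refl
∑-split (suc a) b f = trans (cong (f 0 +_) (∑-split a b (f ∘ suc))) (sym (+-assoc (f 0) _ _))

∑-swap : ∀ a b (f : ℕ → ℕ → ℕ) → ∑ a (λ i → ∑ b (f i)) ≡ ∑ b (λ j → ∑ a (λ i → f i j))
∑-swap zero    b f = sym (∑-zero b (λ _ _ → refl))
∑-swap (suc a) b f =
  trans (cong (∑ b (f 0) +_) (∑-swap a b (f ∘ suc))) (sym (∑-+ b (f 0) _))

-- No term can make up for a loss in another. Used to turn the total number of swaps into exact
-- information about each pair.
∑-tight : ∀ n {f g} → (∀ i → i < n → f i ≤ g i) → ∑ n g ≤ ∑ n f → ∀ i → i < n → f i ≡ g i
∑-tight (suc n) {f} {g} le ge zero _ = ≤-antisym (le 0 z<s)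
  (+-cancelʳ-≤ (∑ n (f ∘ suc)) (g 0) (f 0)
    (≤-trans (+-monoʳ-≤ (g 0) (∑-mono n (λ i i<n → le (suc i) (s<s i<n)))) ge))
∑-tight (suc n) {f} {g} le ge (suc i) i<n =
  ∑-tight n (λ j j<n → le (suc j) (s<s j<n))
    (+-cancelˡ-≤ (f 0) _ _ (≤-trans (+-monoˡ-≤ _ (le 0 z<s)) ge)) i (s<s⁻¹ i<n)

-- A conservation law with gains `a` and losses `b` kept on opposite sides, since truncated
-- subtraction would not telescope.
∑-telescope : ∀ t (g a b : ℕ → ℕ) → (∀ u → u < t → g (suc u) + b u ≡ g u + a u) →
  g t + ∑ t b ≡ g 0 + ∑ t a
∑-telescope zero    g a b h = refl
∑-telescope (suc t) g a b h = begin
  g (suc t) + (b 0 + ∑ t (b ∘ suc))  ≡⟨ +-swapˡ (g (suc t)) (b 0) _ ⟩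
  b 0 + (g (suc t) + ∑ t (b ∘ suc))  ≡⟨ cong (b 0 +_) (∑-telescope t (g ∘ suc) _ _ (λ u u<t → h (suc u) (s<s u<t))) ⟩
  b 0 + (g 1 + ∑ t (a ∘ suc))        ≡⟨ +-assoc-swap (b 0) (g 1) _ ⟩
  (g 1 + b 0) + ∑ t (a ∘ suc)        ≡⟨ cong (_+ ∑ t (a ∘ suc)) (h 0 z<s) ⟩
  (g 0 + a 0) + ∑ t (a ∘ suc)        ≡⟨ +-assoc (g 0) (a 0) _ ⟩
  g 0 + (a 0 + ∑ t (a ∘ suc))        ∎
  where
  open ≡-Reasoning
  +-swapˡ : ∀ x y z → x + (y + z) ≡ y + (x + z)
  +-swapˡ = ℕ-Ring.solve-∀
  +-assoc-swap : ∀ x y z → x + (y + z) ≡ y + x + z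
  +-assoc-swap = ℕ-Ring.solve-∀

∑-≤ : ∀ b n f → b ≤ n → ∑ b f ≤ ∑ n f
∑-≤ zero    n       f _   = z≤n
∑-≤ (suc b) (suc n) f b≤n = +-monoʳ-≤ (f 0) (∑-≤ b n (f ∘ suc) (s≤s⁻¹ b≤n))

∑-truncate : ∀ b n f → b ≤ n → (∀ j → b ≤ j → f j ≡ 0) → ∑ n f ≡ ∑ b f
∑-truncate zero    n       f _   h = ∑-zero n (λ j _ → h j z≤n)
∑-truncate (suc b) (suc n) f b≤n h =
  cong (f 0 +_) (∑-truncate b n (f ∘ suc) (s≤s⁻¹ b≤n) (λ j b≤j → h (suc j) (s≤s b≤j)))

∑-split-≤ : ∀ {a n} f → a ≤ n → ∑ n f ≡ ∑ a f + ∑ (n ∸ a) (λ i → f (a + i))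
∑-split-≤ {a} {n} f a≤n =
  trans (cong (λ z → ∑ z f) (sym (m+[n∸m]≡n a≤n))) (∑-split a (n ∸ a) f)

⟦_⟧ : Bool → ℕ
⟦ true ⟧  = 1
⟦ false ⟧ = 0

⟦⟧≤1 : ∀ b → ⟦ b ⟧ ≤ 1
⟦⟧≤1 true  = ≤-refl
⟦⟧≤1 false = z≤n

⟦T⟧ : ∀ {b} → T b → ⟦ b ⟧ ≡ 1
⟦T⟧ {true} _ = refl

⟦¬T⟧ : ∀ {b} → ¬ T b → ⟦ b ⟧ ≡ 0
⟦¬T⟧ {true}  h = ⊥-elim (h _)
⟦¬T⟧ {false} h = refl

[_≈_] : ℕ → ℕ → ℕ
[ i ≈ j ] = ⟦ i ≡ᵇ j ⟧

[_≺_] : ℕ → ℕ → ℕ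
[ i ≺ j ] = ⟦ i <ᵇ j ⟧

≺-yes : ∀ {i j} → i < j → [ i ≺ j ] ≡ 1
≺-yes i<j = ⟦T⟧ (<⇒<ᵇ i<j)

≺-no : ∀ {i j} → j ≤ i → [ i ≺ j ] ≡ 0
≺-no {i} {j} j≤i = ⟦¬T⟧ (λ t → <⇒≱ (<ᵇ⇒< i j t) j≤i)

≺-asym : ∀ i j → [ i ≺ j ] + [ j ≺ i ] + [ i ≈ j ] ≡ 1
≺-asym zero    zero    = refl
≺-asym zero    (suc j) = refl
≺-asym (suc i) zero    = refl
≺-asym (suc i) (suc j) = ≺-asym i j

∑-≺ : ∀ n i → i ≤ n → ∑ n (λ x → [ x ≺ i ]) ≡ i
∑-≺ n       zero    _   = ∑-zero n (λ _ _ → refl)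
∑-≺ (suc n) (suc i) i≤n = cong suc (∑-≺ n i (s≤s⁻¹ i≤n))

∑-≈ : ∀ n i → i < n → ∑ n (λ x → [ x ≈ i ]) ≡ 1
∑-≈ (suc n) zero    _   = cong suc (∑-zero n (λ _ _ → refl))
∑-≈ (suc n) (suc i) i<n = ∑-≈ n i (s<s⁻¹ i<n)

∑-restrict : ∀ n p h → p ≤ n → ∑ n (λ i → [ i ≺ p ] * h i) ≡ ∑ p h
∑-restrict n       zero    h _   = ∑-zero n (λ _ _ → refl)
∑-restrict (suc n) (suc p) h p≤n =
  cong₂ _+_ (*-identityˡ (h 0)) (∑-restrict n p (h ∘ suc) (s≤s⁻¹ p≤n))

∑-id : ∀ n → n C 2 ≡ ∑ n id
∑-id zero    = refl
∑-id (suc n) = begin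
  suc n C 2                ≡⟨ sym (nCk+nC[k+1]≡[n+1]C[k+1] n 1) ⟩
  n C 1 + n C 2            ≡⟨ cong₂ _+_ (nC1≡n n) (∑-id n) ⟩
  n + ∑ n id               ≡⟨ cong (_+ ∑ n id) (sym (*-identityʳ n)) ⟩
  n * 1 + ∑ n id           ≡⟨ cong (_+ ∑ n id) (sym (∑-const n 1)) ⟩
  ∑ n (λ _ → 1) + ∑ n id   ≡⟨ sym (∑-+ n (λ _ → 1) id) ⟩
  ∑ n suc                  ∎
  where open ≡-Reasoning

2C2 : ∀ n → 2 * (n C 2) + n ≡ n * n
2C2 zero    = refl
2C2 (suc n) = begin
  2 * (suc n C 2) + suc n          ≡⟨ cong (λ z → 2 * z + suc n) (sym (nCk+nC[k+1]≡[n+1]C[k+1] n 1)) ⟩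
  2 * (n C 1 + n C 2) + suc n      ≡⟨ cong (λ z → 2 * (z + n C 2) + suc n) (nC1≡n n) ⟩
  2 * (n + n C 2) + suc n          ≡⟨ regroup n (n C 2) ⟩
  2 * (n C 2) + n + (2 * n + 1)    ≡⟨ cong (_+ (2 * n + 1)) (2C2 n) ⟩
  n * n + (2 * n + 1)              ≡⟨ square n ⟩
  suc n * suc n                    ∎
  where
  open ≡-Reasoning
  regroup : ∀ a b → 2 * (a + b) + suc a ≡ 2 * b + a + (2 * a + 1)
  regroup = ℕ-Ring.solve-∀
  square : ∀ a → a * a + (2 * a + 1) ≡ suc a * suc a
  square = ℕ-Ring.solve-∀

-- Adjacent transpositions

σ : ℕ → ℕ → ℕ
σ zero    zero          = 1
σ zero    (suc zero)    = 0
σ zero    (suc (suc i)) = suc (suc i)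
σ (suc p) zero          = zero
σ (suc p) (suc i)       = suc (σ p i)

σ-involutive : ∀ p i → σ p (σ p i) ≡ i
σ-involutive zero    zero          = refl
σ-involutive zero    (suc zero)    = refl
σ-involutive zero    (suc (suc i)) = refl
σ-involutive (suc p) zero          = refl
σ-involutive (suc p) (suc i)       = cong suc (σ-involutive p i)

σ-< : ∀ {n} p i → suc p < n → i < n → σ p i < n
σ-< zero    zero          p<n i<n = p<n
σ-< zero    (suc zero)    p<n i<n = <-trans z<s i<n
σ-< zero    (suc (suc i)) p<n i<n = i<n
σ-< (suc p) zero          p<n i<n = i<n
σ-< {suc n} (suc p) (suc i) p<n i<n = s<s (σ-< p i (s<s⁻¹ p<n) (s<s⁻¹ i<n))

∑-σ : ∀ n p f → suc p < n → ∑ n (f ∘ σ p) ≡ ∑ n f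
∑-σ (suc zero) zero f (s<s ())
∑-σ (suc (suc n)) zero f _ = +-swapˡ (f 1) (f 0) _
  where
  +-swapˡ : ∀ x y z → x + (y + z) ≡ y + (x + z)
  +-swapˡ = ℕ-Ring.solve-∀
∑-σ (suc n) (suc p) f p<n = cong (f 0 +_) (∑-σ n p (f ∘ suc) (s<s⁻¹ p<n))

-- Only a pair occupying positions `p` and `suc p` changes its order; the correction terms have the
-- form that `∑-telescope` takes.
σ-≺ : ∀ p i j → [ σ p i ≺ σ p j ] + [ i ≈ p ] * [ j ≈ suc p ] ≡ [ i ≺ j ] + [ j ≈ p ] * [ i ≈ suc p ]
σ-≺ zero zero          zero          = refl
σ-≺ zero zero          (suc zero)    = refl
σ-≺ zero zero          (suc (suc j)) = refl
σ-≺ zero (suc zero)    zero          = refl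
σ-≺ zero (suc zero)    (suc zero)    = refl
σ-≺ zero (suc zero)    (suc (suc j)) = refl
σ-≺ zero (suc (suc i)) zero          = refl
σ-≺ zero (suc (suc i)) (suc zero)    = refl
σ-≺ zero (suc (suc i)) (suc (suc j)) = refl
σ-≺ (suc p) zero    zero    = refl
σ-≺ (suc p) zero    (suc j) = cong suc (sym (*-zeroʳ [ j ≈ p ]))
σ-≺ (suc p) (suc i) zero    = *-zeroʳ [ i ≈ p ]
σ-≺ (suc p) (suc i) (suc j) = σ-≺ p i j

-- The element leaving `p` gains the increment of `f`, the one leaving `suc p` loses it, and no
-- other moves.
σ-increment : ∀ p (f : ℕ → ℕ) → f p ≤ f (suc p) → ∀ i →
  f (σ p i) + (f (suc p) ∸ f p) * [ i ≈ suc p ] ≡ f i + (f (suc p) ∸ f p) * [ i ≈ p ]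
σ-increment zero f le zero rewrite *-zeroʳ (f 1 ∸ f 0) | *-identityʳ (f 1 ∸ f 0) =
  trans (+-identityʳ (f 1)) (sym (m+[n∸m]≡n le))
σ-increment zero f le (suc zero) rewrite *-zeroʳ (f 1 ∸ f 0) | *-identityʳ (f 1 ∸ f 0) =
  trans (m+[n∸m]≡n le) (sym (+-identityʳ (f 1)))
σ-increment zero    f le (suc (suc i)) = refl
σ-increment (suc p) f le zero          = refl
σ-increment (suc p) f le (suc i)       = σ-increment p (f ∘ suc) le i

-- Acyclic digraphs in which no out-degree exceeds the in-degree by more than d

module Digraph (n d : ℕ) (F : ℕ → ℕ → ℕ) (F≤≺ : ∀ i j → i < n → j < n → F i j ≤ [ i ≺ j ]) where

  indegree outdegree : ℕ → ℕ
  indegree  i = ∑ n (λ j → F j i)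
  outdegree i = ∑ n (F i)

  -- Edges point from smaller to larger indices, so these in-degrees count exactly the edges among
  -- the first `b` vertices.
  edges : ℕ → ℕ
  edges b = ∑ b indegree

  F-descending : ∀ {i j} → i < n → j < n → j ≤ i → F i j ≡ 0
  F-descending {i} {j} i<n j<n j≤i =
    n≤0⇒n≡0 (≤-trans (F≤≺ i j i<n j<n) (≤-reflexive (≺-no j≤i)))

  -- An edge entering one of the first a + h vertices either leaves one of the
  -- first a vertices or joins two of the last h.
  edges-grow : ∀ a h → a + h ≤ n → (∀ i → i < a → outdegree i ≤ d + indegree i) →
    edges (a + h) ≤ a * d + edges a + h C 2
  edges-grow a h a+h≤n excess = begin
    edges (a + h)
      ≤⟨ ∑-mono (a + h) indegree-≤ ⟩
    ∑ (a + h) (λ i → ∑ a (λ j → F j i) + ∑ h (λ l → F (a + l) i))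
      ≡⟨ ∑-+ (a + h) _ _ ⟩
    ∑ (a + h) (λ i → ∑ a (λ j → F j i)) + ∑ (a + h) (λ i → ∑ h (λ l → F (a + l) i))
      ≤⟨ +-mono-≤ leaving inside ⟩
    a * d + edges a + h C 2 ∎
    where
    open ≤-Reasoning
    a≤n : a ≤ n
    a≤n = ≤-trans (m≤m+n a h) a+h≤n
    below : ∀ {l} → l < h → a + l < n
    below l<h = <-≤-trans (+-monoʳ-< a l<h) a+h≤n

    indegree-≤ : ∀ i → i < a + h → indegree i ≤ ∑ a (λ j → F j i) + ∑ h (λ l → F (a + l) i)
    indegree-≤ i i<a+h = begin
      ∑ n (λ j → F j i)
        -- The factor `[ j ≺ i ]` lets the sum be cut off at `a + h`, beyond which no source of `i`
        -- lies.
        ≤⟨ ∑-mono n (λ j j<n → F≤≺ʳ j j<n) ⟩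
      ∑ n (λ j → [ j ≺ i ] * F j i)
        ≡⟨ ∑-truncate (a + h) n _ a+h≤n (λ j b≤j → cong (_* F j i) (≺-no (≤-trans (<⇒≤ i<a+h) b≤j))) ⟩
      ∑ (a + h) (λ j → [ j ≺ i ] * F j i)
        ≤⟨ ∑-mono (a + h) (λ j _ → ≤-trans (*-monoˡ-≤ (F j i) (⟦⟧≤1 (j <ᵇ i))) (≤-reflexive (*-identityˡ _))) ⟩
      ∑ (a + h) (λ j → F j i)
        ≡⟨ ∑-split a h _ ⟩
      ∑ a (λ j → F j i) + ∑ h (λ l → F (a + l) i) ∎
      where
      F≤≺ʳ : ∀ j → j < n → F j i ≤ [ j ≺ i ] * F j i
      F≤≺ʳ j j<n with <-≤-connex j i
      ... | inj₁ j<i rewrite ≺-yes j<i = ≤-reflexive (sym (*-identityˡ _))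
      ... | inj₂ i≤j rewrite F-descending j<n (<-≤-trans i<a+h a+h≤n) i≤j = z≤n

    leaving : ∑ (a + h) (λ i → ∑ a (λ j → F j i)) ≤ a * d + edges a
    leaving = begin
      ∑ (a + h) (λ i → ∑ a (λ j → F j i))  ≡⟨ ∑-swap (a + h) a _ ⟩
      -- Counted from the tails, the out-degree of each of the first `a` vertices is traded for `d`
      -- plus its in-degree.
      ∑ a (λ j → ∑ (a + h) (F j))          ≤⟨ ∑-mono a (λ j j<a → ≤-trans (∑-≤ (a + h) n (F j) a+h≤n) (excess j j<a)) ⟩
      ∑ a (λ j → d + indegree j)           ≡⟨ ∑-+ a (λ _ → d) indegree ⟩
      ∑ a (λ _ → d) + edges a              ≡⟨ cong (_+ edges a) (∑-const a d) ⟩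
      a * d + edges a                      ∎

    inside : ∑ (a + h) (λ i → ∑ h (λ l → F (a + l) i)) ≤ h C 2
    inside = begin
      ∑ (a + h) (λ i → ∑ h (λ l → F (a + l) i))
        ≡⟨ ∑-split a h _ ⟩
      ∑ a (λ i → ∑ h (λ l → F (a + l) i)) + ∑ h (λ i → ∑ h (λ l → F (a + l) (a + i)))
        ≡⟨ cong (_+ ∑ h (λ i → ∑ h (λ l → F (a + l) (a + i)))) (∑-zero a (λ i i<a → ∑-zero h (λ l l<h →
             F-descending (below l<h) (<-≤-trans i<a a≤n) (≤-trans (<⇒≤ i<a) (m≤m+n a l))))) ⟩
      ∑ h (λ i → ∑ h (λ l → F (a + l) (a + i)))
        ≤⟨ ∑-mono h (λ i i<h → ∑-mono h (λ l l<h →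
             ≤-trans (F≤≺ (a + l) (a + i) (below l<h) (below i<h)) (≤-reflexive (≺-shift a l i)))) ⟩
      ∑ h (λ i → ∑ h (λ l → [ l ≺ i ]))
        ≡⟨ ∑-cong h (λ i i<h → ∑-≺ h i (<⇒≤ i<h)) ⟩
      ∑ h id
        ≡⟨ sym (∑-id h) ⟩
      h C 2 ∎
      where
      ≺-shift : ∀ a l i → [ a + l ≺ a + i ] ≡ [ l ≺ i ]
      ≺-shift zero    l i = refl
      ≺-shift (suc a) l i = ≺-shift a l i

-- Sequences of adjacent transpositions: q t x is the position at time t of the
-- element that starts in position x.

module Swaps (n N : ℕ) (p : ℕ → ℕ) (p< : ∀ u → u < N → suc (p u) < n) where

  q q⁻¹ : ℕ → ℕ → ℕ
  q zero    x = x
  q (suc t) x = σ (p t) (q t x)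
  q⁻¹ zero    i = i
  q⁻¹ (suc t) i = q⁻¹ t (σ (p t) i)

  q⁻¹-q : ∀ t x → q⁻¹ t (q t x) ≡ x
  q⁻¹-q zero    x = refl
  q⁻¹-q (suc t) x = trans (cong (q⁻¹ t) (σ-involutive (p t) (q t x))) (q⁻¹-q t x)

  q-q⁻¹ : ∀ t i → q t (q⁻¹ t i) ≡ i
  q-q⁻¹ zero    i = refl
  q-q⁻¹ (suc t) i = trans (cong (σ (p t)) (q-q⁻¹ t (σ (p t) i))) (σ-involutive (p t) i)

  q⁻¹-< : ∀ t i → t ≤ N → i < n → q⁻¹ t i < n
  q⁻¹-< zero    i _   i<n = i<n
  q⁻¹-< (suc t) i t<N i<n = q⁻¹-< t (σ (p t) i) (<⇒≤ t<N) (σ-< (p t) i (p< t t<N) i<n)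

  ∑-q : ∀ t f → t ≤ N → ∑ n (f ∘ q t) ≡ ∑ n f
  ∑-q zero    f _   = refl
  ∑-q (suc t) f t<N = trans (∑-q t (f ∘ σ (p t)) (<⇒≤ t<N)) (∑-σ n (p t) f (p< t t<N))

  ∑-q⁻¹ : ∀ t f → t ≤ N → ∑ n (f ∘ q⁻¹ t) ≡ ∑ n f
  ∑-q⁻¹ t f t≤N =
    trans (sym (∑-q t (f ∘ q⁻¹ t) t≤N)) (∑-cong n (λ x _ → cong f (q⁻¹-q t x)))

  ∑-position : ∀ t i → t ≤ N → i < n → ∑ n (λ x → [ q t x ≈ i ]) ≡ 1
  ∑-position t i t≤N i<n = trans (∑-q t (λ z → [ z ≈ i ]) t≤N) (∑-≈ n i i<n)

  -- A u x y indicates that swap u moves x to the right past y.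
  A : ℕ → ℕ → ℕ → ℕ
  A u x y = [ q u x ≈ p u ] * [ q u y ≈ suc (p u) ]

  ∑-A-right : ∀ u x → u < N → ∑ n (λ y → A u x y) ≡ [ q u x ≈ p u ]
  ∑-A-right u x u<N = trans (∑-*ˡ n [ q u x ≈ p u ] _)
    (trans (cong ([ q u x ≈ p u ] *_) (∑-position u (suc (p u)) (<⇒≤ u<N) (p< u u<N))) (*-identityʳ _))

  ∑-A-left : ∀ u x → u < N → ∑ n (λ y → A u y x) ≡ [ q u x ≈ suc (p u) ]
  ∑-A-left u x u<N = trans (∑-*ʳ n [ q u x ≈ suc (p u) ] _)
    (trans (cong (_* [ q u x ≈ suc (p u) ]) (∑-position u (p u) (<⇒≤ u<N) (<-trans (n<1+n _) (p< u u<N))))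
      (*-identityˡ _))

  D : ℕ → ℕ → ℕ → ℕ
  D t x y = ∑ t (λ u → A u x y)

  order : ∀ t x y → [ q t x ≺ q t y ] + D t x y ≡ [ x ≺ y ] + D t y x
  order t x y = ∑-telescope t (λ t → [ q t x ≺ q t y ]) (λ u → A u y x) (λ u → A u x y)
    (λ u _ → σ-≺ (p u) (q u x) (q u y))

  -- Each swap has one element moving right and one that it passes, hence is counted for a single
  -- ordered pair.
  ∑∑D : ∑ n (λ x → ∑ n (D N x)) ≡ N
  ∑∑D = begin
    ∑ n (λ x → ∑ n (λ y → ∑ N (λ u → A u x y)))
      ≡⟨ ∑-cong n (λ x _ → trans (∑-swap n N _) (∑-cong N (λ u u<N → ∑-A-right u x u<N))) ⟩
    ∑ n (λ x → ∑ N (λ u → [ q u x ≈ p u ]))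
      ≡⟨ ∑-swap n N _ ⟩
    ∑ N (λ u → ∑ n (λ x → [ q u x ≈ p u ]))
      ≡⟨ ∑-cong N (λ u u<N → ∑-position u (p u) (<⇒≤ u<N) (<-trans (n<1+n _) (p< u u<N))) ⟩
    ∑ N (λ _ → 1)
      ≡⟨ trans (∑-const N 1) (*-identityʳ N) ⟩
    N ∎
    where open ≡-Reasoning

  -- Reversing the order in C(n,2) swaps

  module Reversing (N≡ : N ≡ n C 2) (q-N : ∀ x → x < n → q N x ≡ n ∸ suc x) where

    ∑∑≺ : ∑ n (λ x → ∑ n (λ y → [ x ≺ y ])) ≡ N
    ∑∑≺ = trans (∑-swap n n _) (trans (∑-cong n (λ y y<n → ∑-≺ n y (<⇒≤ y<n)))
      (trans (sym (∑-id n)) (sym N≡)))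

    -- A pair with `x < y` ends in the opposite order, and by `order` that takes at least one move
    -- of `x` past `y`.
    ≺≤D : ∀ x y → x < n → y < n → [ x ≺ y ] ≤ D N x y
    ≺≤D x y x<n y<n with <-≤-connex x y
    ... | inj₂ y≤x rewrite ≺-no y≤x = z≤n
    ... | inj₁ x<y = begin
      [ x ≺ y ]                        ≤⟨ m≤m+n _ (D N y x) ⟩
      [ x ≺ y ] + D N y x              ≡⟨ sym (order N x y) ⟩
      [ q N x ≺ q N y ] + D N x y      ≡⟨ cong (_+ D N x y) (cong₂ [_≺_] (q-N x x<n) (q-N y y<n)) ⟩
      [ n ∸ suc x ≺ n ∸ suc y ] + D N x y  ≡⟨ cong (_+ D N x y) (≺-no (∸-monoʳ-≤ n (s≤s (<⇒≤ x<y)))) ⟩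
      D N x y                          ∎
      where open ≤-Reasoning

    -- N swaps suffice only if every swap moves the smaller element to the right.
    D-final : ∀ x y → x < n → y < n → D N x y ≡ [ x ≺ y ]
    D-final x y x<n y<n = sym (∑-tight n (λ y y<n → ≺≤D x y x<n y<n) (≤-reflexive (sym row)) y y<n)
      where
      row : ∑ n (λ y → [ x ≺ y ]) ≡ ∑ n (D N x)
      row = ∑-tight n (λ x x<n → ∑-mono n (λ y y<n → ≺≤D x y x<n y<n))
        (≤-reflexive (trans ∑∑D (sym ∑∑≺))) x x<n

    -- Every pair is swapped once. So `x` is ahead at time `T` if `y` has already moved right past
    -- it or if it has yet to move right past `y`, and never for both reasons.
    order-from : ∀ T x y → T ≤ N → x < n → y < n →
      D T y x + ∑ (N ∸ T) (λ v → A (T + v) x y) ≡ [ q T x ≺ q T y ]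
    order-from T x y T≤N x<n y<n = +-cancelˡ-≡ (D T x y) _ _ (begin
      D T x y + (D T y x + D′)         ≡⟨ rotate (D T x y) (D T y x) D′ ⟩
      (D T x y + D′) + D T y x         ≡⟨ cong (_+ D T y x) (trans (sym (∑-split-≤ _ T≤N)) (D-final x y x<n y<n)) ⟩
      [ x ≺ y ] + D T y x              ≡⟨ sym (order T x y) ⟩
      [ q T x ≺ q T y ] + D T x y      ≡⟨ +-comm _ (D T x y) ⟩
      D T x y + [ q T x ≺ q T y ]      ∎)
      where
      open ≡-Reasoning
      D′ = ∑ (N ∸ T) (λ v → A (T + v) x y)
      rotate : ∀ a b c → a + (b + c) ≡ a + c + b
      rotate = ℕ-Ring.solve-∀

    -- Passage through the central positions

    module Central (k d : ℕ) (n≡ : n ≡ suc (k + (k + d))) where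

      -- Progress through the centre: 0 up to position `k`, then rising by 1 per position, and `d`
      -- from position `k + d` on. Positions count from 0, so the swap at `p` is the transposition
      -- of index p + 1, and `φ` rises exactly at the indices k + 1, ..., n - k - 1.
      φ : ℕ → ℕ
      φ i = (i ∸ k) ⊓ d

      φ-suc : ∀ i → φ i ≤ φ (suc i)
      φ-suc i = ⊓-monoˡ-≤ d (∸-monoˡ-≤ k (n≤1+n i))

      φ-early : ∀ {i} → i ≤ k → φ i ≡ 0
      φ-early i≤k = cong (_⊓ d) (m≤n⇒m∸n≡0 i≤k)

      φ-mirror : ∀ x → x < n → φ x + φ (n ∸ suc x) ≡ d
      φ-mirror x x<n with ≤-total x k
      ... | inj₁ x≤k rewrite φ-early x≤k | n≡ = m≥n⇒m⊓n≡n (begin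
        d                       ≡⟨ sym (m+n∸m≡n (k + k) d) ⟩
        k + k + d ∸ (k + k)     ≤⟨ ∸-monoʳ-≤ (k + k + d) (+-monoˡ-≤ k x≤k) ⟩
        k + k + d ∸ (x + k)     ≡⟨ cong (_∸ (x + k)) (+-assoc k k d) ⟩
        k + (k + d) ∸ (x + k)   ≡⟨ sym (∸-+-assoc (k + (k + d)) x k) ⟩
        k + (k + d) ∸ x ∸ k     ∎)
        where open ≤-Reasoning
      ... | inj₂ k≤x = begin
        φ x + φ (n ∸ suc x)             ≡⟨ cong (λ z → φ x + (z ∸ k) ⊓ d) (cong (_∸ suc x) n≡) ⟩
        φ x + (k + (k + d) ∸ x ∸ k) ⊓ d ≡⟨ cong (λ z → φ x + z ⊓ d) far ⟩
        φ x + (d ∸ (x ∸ k)) ⊓ d         ≡⟨ cong (φ x +_) (m≤n⇒m⊓n≡m (m∸n≤m d (x ∸ k))) ⟩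
        (x ∸ k) ⊓ d + (d ∸ (x ∸ k))     ≡⟨ m⊓n+n∸m≡n (x ∸ k) d ⟩
        d                               ∎
        where
        open ≡-Reasoning
        far : k + (k + d) ∸ x ∸ k ≡ d ∸ (x ∸ k)
        far = begin
          k + (k + d) ∸ x ∸ k               ≡⟨ cong (λ z → k + (k + d) ∸ z ∸ k) (sym (m+[n∸m]≡n k≤x)) ⟩
          k + (k + d) ∸ (k + (x ∸ k)) ∸ k   ≡⟨ cong (_∸ k) ([m+n]∸[m+o]≡n∸o k (k + d) (x ∸ k)) ⟩
          k + d ∸ (x ∸ k) ∸ k               ≡⟨ ∸-+-assoc (k + d) (x ∸ k) k ⟩
          k + d ∸ (x ∸ k + k)               ≡⟨ cong (k + d ∸_) (+-comm (x ∸ k) k) ⟩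
          k + d ∸ (k + (x ∸ k))             ≡⟨ [m+n]∸[m+o]≡n∸o k d (x ∸ k) ⟩
          d ∸ (x ∸ k)                       ∎

      -- The slope of `φ` at the swap serves as the indicator of central swaps; see `critical⇒mid≡0`
      -- and `central⇒mid≡1`.
      mid : ℕ → ℕ
      mid u = φ (suc (p u)) ∸ φ (p u)

      mid≤1 : ∀ u → mid u ≤ 1
      mid≤1 u = begin
        φ (suc i) ∸ φ i                   ≤⟨ ∸-monoˡ-≤ (φ i) (⊓-mono-≤ (∸-suc-≤ i k) (n≤1+n d)) ⟩
        suc (φ i) ∸ φ i                   ≡⟨ m+n∸n≡m 1 (φ i) ⟩
        1                                 ∎
        where
        open ≤-Reasoning
        i = p u
        ∸-suc-≤ : ∀ a b → suc a ∸ b ≤ suc (a ∸ b)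
        ∸-suc-≤ a       zero    = ≤-refl
        ∸-suc-≤ zero    (suc b) = ≤-trans (m∸n≤m 0 b) z≤n
        ∸-suc-≤ (suc a) (suc b) = ∸-suc-≤ a b

      right left : ℕ → ℕ → ℕ
      right x u = mid u * [ q u x ≈ p u ]
      left  x u = mid u * [ q u x ≈ suc (p u) ]

      -- Central swaps alone change `φ`, by +1 for the right mover and by -1 for the left mover.
      flow : ∀ t x → φ (q t x) + ∑ t (left x) ≡ φ x + ∑ t (right x)
      flow t x = ∑-telescope t (λ t → φ (q t x)) (right x) (left x)
        (λ u _ → σ-increment (p u) φ (φ-suc (p u)) (q u x))

      module At (T : ℕ) (T≤N : T ≤ N) where

        private
          T+v<N : ∀ v → v < N ∸ T → T + v < N
          T+v<N v v<M = <-≤-trans (+-monoʳ-< T v<M) (≤-reflexive (m+[n∸m]≡n T≤N))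

        -- The central swaps of x and y, oriented from x to y if x precedes y at time T.
        F : ℕ → ℕ → ℕ
        F x y = ∑ T (λ u → mid u * A u y x) + ∑ (N ∸ T) (λ v → mid (T + v) * A (T + v) x y)

        F≤ : ∀ x y → x < n → y < n → F x y ≤ [ q T x ≺ q T y ]
        F≤ x y x<n y<n = ≤-trans
          (+-mono-≤ (∑-mono T (λ u _ → *≤1 (mid≤1 u))) (∑-mono (N ∸ T) (λ v _ → *≤1 (mid≤1 (T + v)))))
          (≤-reflexive (order-from T x y T≤N x<n y<n))
          where
          *≤1 : ∀ {a b} → a ≤ 1 → a * b ≤ b
          *≤1 {a} {b} a≤1 = ≤-trans (*-monoˡ-≤ b a≤1) (≤-reflexive (*-identityˡ b))

        -- An edge leaves `x` if `x` is ahead at time `T`: it moved left in that swap before `T`, or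
        -- moves right in it afterwards. For incoming edges the directions are exchanged.
        out in′ : ℕ → ℕ
        out x = ∑ T (left x) + ∑ (N ∸ T) (λ v → right x (T + v))
        in′ x = ∑ T (right x) + ∑ (N ∸ T) (λ v → left x (T + v))

        ∑-F-out : ∀ x → ∑ n (F x) ≡ out x
        ∑-F-out x = trans (∑-+ n _ _) (cong₂ _+_
          (trans (∑-swap n T _) (∑-cong T (λ u u<T →
            trans (∑-*ˡ n (mid u) _) (cong (mid u *_) (∑-A-left u x (<-≤-trans u<T T≤N))))))
          (trans (∑-swap n (N ∸ T) _) (∑-cong (N ∸ T) (λ v v<M →
            trans (∑-*ˡ n (mid (T + v)) _) (cong (mid (T + v) *_) (∑-A-right (T + v) x (T+v<N v v<M)))))))

        ∑-F-in : ∀ x → ∑ n (λ y → F y x) ≡ in′ x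
        ∑-F-in x = trans (∑-+ n _ _) (cong₂ _+_
          (trans (∑-swap n T _) (∑-cong T (λ u u<T →
            trans (∑-*ˡ n (mid u) _) (cong (mid u *_) (∑-A-right u x (<-≤-trans u<T T≤N))))))
          (trans (∑-swap n (N ∸ T) _) (∑-cong (N ∸ T) (λ v v<M →
            trans (∑-*ˡ n (mid (T + v)) _) (cong (mid (T + v) *_) (∑-A-left (T + v) x (T+v<N v v<M)))))))

        -- Outside the centre at time T, x crosses the centre once in each direction of
        -- time; by φ-mirror both crossings together have length d.
        out≡d+in : ∀ x → x < n → q T x ≤ k → out x ≡ d + in′ x
        out≡d+in x x<n qx≤k = begin
          out x
            ≡⟨ cong (_+ R′) (trans (cong (_+ L) (sym (φ-early qx≤k))) (flow T x)) ⟩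
          φ x + R + R′
            ≡⟨ cong (φ x + R +_) after ⟩
          φ x + R + (φ (q N x) + L′)
            ≡⟨ regroup (φ x) R (φ (q N x)) L′ ⟩
          φ x + φ (q N x) + in′ x
            ≡⟨ cong (_+ in′ x) (trans (cong (λ z → φ x + φ z) (q-N x x<n)) (φ-mirror x x<n)) ⟩
          d + in′ x ∎
          where
          open ≡-Reasoning
          L = ∑ T (left x)
          R = ∑ T (right x)
          L′ = ∑ (N ∸ T) (λ v → left x (T + v))
          R′ = ∑ (N ∸ T) (λ v → right x (T + v))
          regroup : ∀ a b c e → a + b + (c + e) ≡ a + c + (b + e)
          regroup = ℕ-Ring.solve-∀
          exchange : ∀ a b c → a + b + c ≡ b + (a + c)
          exchange = ℕ-Ring.solve-∀
          -- The flow from `T` to `N` is the difference of the flows up to `N` and up to `T`.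
          after : R′ ≡ φ (q N x) + L′
          after = sym (+-cancelˡ-≡ L _ _ (begin
            L + (φ (q N x) + L′)     ≡⟨ sym (exchange (φ (q N x)) L L′) ⟩
            φ (q N x) + L + L′       ≡⟨ +-assoc (φ (q N x)) L L′ ⟩
            φ (q N x) + (L + L′)     ≡⟨ cong (φ (q N x) +_) (sym (∑-split-≤ (left x) T≤N)) ⟩
            φ (q N x) + ∑ N (left x) ≡⟨ flow N x ⟩
            φ x + ∑ N (right x)      ≡⟨ cong (φ x +_) (∑-split-≤ (right x) T≤N) ⟩
            φ x + (R + R′)           ≡⟨ sym (+-assoc (φ x) R R′) ⟩
            φ x + R + R′             ≡⟨ cong (_+ R′) (sym (flow T x)) ⟩
            φ (q T x) + L + R′       ≡⟨ cong (λ z → z + L + R′) (φ-early qx≤k) ⟩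
            L + R′                   ∎))

        -- Vertices are renamed by their positions at time `T`, so that edges point to larger
        -- numbers as `Digraph` demands.
        F~ : ℕ → ℕ → ℕ
        F~ i j = F (q⁻¹ T i) (q⁻¹ T j)

        F~≤ : ∀ i j → i < n → j < n → F~ i j ≤ [ i ≺ j ]
        F~≤ i j i<n j<n = ≤-trans
          (F≤ (q⁻¹ T i) (q⁻¹ T j) (q⁻¹-< T i T≤N i<n) (q⁻¹-< T j T≤N j<n))
          (≤-reflexive (cong₂ [_≺_] (q-q⁻¹ T i) (q-q⁻¹ T j)))

        open Digraph n d F~ F~≤ public

        outdegree≡out : ∀ i → outdegree i ≡ out (q⁻¹ T i)
        outdegree≡out i = trans (∑-q⁻¹ T (F (q⁻¹ T i)) T≤N) (∑-F-out (q⁻¹ T i))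

        indegree≡in : ∀ i → indegree i ≡ in′ (q⁻¹ T i)
        indegree≡in i = trans (∑-q⁻¹ T (λ y → F y (q⁻¹ T i)) T≤N) (∑-F-in (q⁻¹ T i))

        excess : ∀ i → i < n → i ≤ k → outdegree i ≡ d + indegree i
        excess i i<n i≤k rewrite outdegree≡out i | indegree≡in i =
          out≡d+in (q⁻¹ T i) (q⁻¹-< T i T≤N i<n) (≤-trans (≤-reflexive (q-q⁻¹ T i)) i≤k)

        degree≡ : ∀ x → ∑ N (λ u → left x u + right x u) ≡ out x + in′ x
        degree≡ x = begin
          ∑ N (λ u → left x u + right x u)
            ≡⟨ ∑-+ N _ _ ⟩
          ∑ N (left x) + ∑ N (right x)
            ≡⟨ cong₂ _+_ (∑-split-≤ (left x) T≤N) (∑-split-≤ (right x) T≤N) ⟩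
          ∑ T (left x) + ∑ (N ∸ T) (λ v → left x (T + v)) + (∑ T (right x) + ∑ (N ∸ T) (λ v → right x (T + v)))
            ≡⟨ regroup (∑ T (left x)) _ _ _ ⟩
          out x + in′ x ∎
          where
          open ≡-Reasoning
          regroup : ∀ a b c e → a + b + (c + e) ≡ a + e + (c + b)
          regroup = ℕ-Ring.solve-∀

      degree : ℕ → ℕ
      degree x = ∑ N (λ u → left x u + right x u)

      -- Each other element meets `x` in at most one swap, as the digraph at time 0 shows.
      degree< : ∀ x → x < n → degree x < n
      degree< x x<n = begin
        suc (degree x)                             ≡⟨ cong suc (trans (degree≡ x) (cong₂ _+_ (sym (∑-F-out x)) (sym (∑-F-in x)))) ⟩
        suc (∑ n (F x) + ∑ n (λ y → F y x))   ≡⟨ +-comm 1 _ ⟩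
        ∑ n (F x) + ∑ n (λ y → F y x) + 1     ≤⟨ +-monoˡ-≤ 1 (+-mono-≤ (∑-mono n (λ y y<n → F≤ x y x<n y<n))
                                                                      (∑-mono n (λ y y<n → F≤ y x y<n x<n))) ⟩
        ∑ n (λ y → [ x ≺ y ]) + ∑ n (λ y → [ y ≺ x ]) + 1
          ≡⟨ cong₂ _+_ (sym (∑-+ n _ _)) (sym (∑-≈ n x x<n)) ⟩
        ∑ n (λ y → [ x ≺ y ] + [ y ≺ x ]) + ∑ n (λ y → [ y ≈ x ])
          ≡⟨ sym (∑-+ n _ _) ⟩
        ∑ n (λ y → [ x ≺ y ] + [ y ≺ x ] + [ y ≈ x ])
          ≡⟨ ∑-cong n (λ y _ → trans (cong (_+ [ y ≈ x ]) (+-comm [ x ≺ y ] _)) (≺-asym y x)) ⟩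
        ∑ n (λ _ → 1)                         ≡⟨ trans (∑-const n 1) (*-identityʳ n) ⟩
        n                                     ∎
        where
        open ≤-Reasoning
        open At 0 z≤n

      ∑-degree : ∑ n degree ≡ 2 * ∑ N mid
      ∑-degree = begin
        ∑ n (λ x → ∑ N (λ u → left x u + right x u))  ≡⟨ ∑-swap n N _ ⟩
        ∑ N (λ u → ∑ n (λ x → left x u + right x u))  ≡⟨ ∑-cong N (λ u u<N → trans (∑-+ n _ _) (cong₂ _+_
              (trans (∑-*ˡ n (mid u) _) (cong (mid u *_) (∑-position u (suc (p u)) (<⇒≤ u<N) (p< u u<N))))
              (trans (∑-*ˡ n (mid u) _) (cong (mid u *_) (∑-position u (p u) (<⇒≤ u<N) (<-trans (n<1+n _) (p< u u<N))))))) ⟩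
        ∑ N (λ u → mid u * 1 + mid u * 1)             ≡⟨ ∑-cong N (λ u _ → double (mid u)) ⟩
        ∑ N (λ u → 2 * mid u)                         ≡⟨ ∑-*ˡ N 2 mid ⟩
        2 * ∑ N mid                                   ∎
        where
        open ≡-Reasoning
        double : ∀ a → a * 1 + a * 1 ≡ 2 * a
        double = ℕ-Ring.solve-∀

      -- For these positions the out-degree is `d` plus the in-degree, so each degree is
      -- `d + 2 * indegree`, and the in-degrees add up to the edges of the prefix.
      ∑-degree-prefix : ∀ T (T≤N : T ≤ N) b → b ≤ n → b ≤ k →
        ∑ n (λ x → [ q T x ≺ b ] * degree x) ≡ b * d + 2 * At.edges T T≤N b
      ∑-degree-prefix T T≤N b b≤n b≤k = begin
        ∑ n (λ x → [ q T x ≺ b ] * degree x)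
          ≡⟨ ∑-cong n (λ x _ → cong (λ z → [ q T x ≺ b ] * degree z) (sym (q⁻¹-q T x))) ⟩
        ∑ n (λ x → [ q T x ≺ b ] * degree (q⁻¹ T (q T x)))
          ≡⟨ ∑-q T (λ i → [ i ≺ b ] * degree (q⁻¹ T i)) T≤N ⟩
        ∑ n (λ i → [ i ≺ b ] * degree (q⁻¹ T i))
          ≡⟨ ∑-restrict n b (degree ∘ q⁻¹ T) b≤n ⟩
        ∑ b (degree ∘ q⁻¹ T)
          ≡⟨ ∑-cong b (λ i i<b → trans (degree≡ (q⁻¹ T i)) (trans
               (cong₂ _+_ (trans (sym (outdegree≡out i)) (excess i (<-≤-trans i<b b≤n) (≤-trans (<⇒≤ i<b) b≤k)))
                          (sym (indegree≡in i)))
               (regroup d (indegree i)))) ⟩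
        ∑ b (λ i → d + 2 * indegree i)
          ≡⟨ trans (∑-+ b _ _) (cong₂ _+_ (∑-const b d) (∑-*ˡ b 2 indegree)) ⟩
        b * d + 2 * edges b ∎
        where
        open ≡-Reasoning
        open At T T≤N
        regroup : ∀ a b → a + b + b ≡ a + 2 * b
        regroup = ℕ-Ring.solve-∀

      -- Members of the three disjoint prefixes have their degrees counted exactly by
      -- `∑-degree-prefix`; every other element has degree at most n - 1. The summand on the left
      -- stands for taking the `3 * b` members off the latter.
      central-bound : ∀ T₁ T₂ T₃ (T₁≤ : T₁ ≤ N) (T₂≤ : T₂ ≤ N) (T₃≤ : T₃ ≤ N) b → b ≤ n → b ≤ k →
        (∀ x → x < n → [ q T₁ x ≺ b ] + [ q T₂ x ≺ b ] + [ q T₃ x ≺ b ] ≤ 1) →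
        2 * ∑ N mid + 3 * b * (n ∸ 1) ≤
          3 * b * d + 2 * (At.edges T₁ T₁≤ b + At.edges T₂ T₂≤ b + At.edges T₃ T₃≤ b) + n * (n ∸ 1)
      central-bound T₁ T₂ T₃ T₁≤ T₂≤ T₃≤ b b≤n b≤k disjoint = begin
        2 * ∑ N mid + 3 * b * (n ∸ 1)
          ≡⟨ cong₂ _+_ (sym ∑-degree) (cong (_* (n ∸ 1)) (sym ∑-K)) ⟩
        ∑ n degree + ∑ n K * (n ∸ 1)
          ≡⟨ trans (cong (∑ n degree +_) (sym (∑-*ʳ n (n ∸ 1) K))) (sym (∑-+ n _ _)) ⟩
        ∑ n (λ x → degree x + K x * (n ∸ 1))
          -- `K x` is 0 or 1: the inequality is `degree x ≤ n ∸ 1` in the first case and an identity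
          -- in the second.
          ≤⟨ ∑-mono n (λ x x<n → convex (disjoint x x<n) (∸-monoˡ-≤ 1 (degree< x x<n))) ⟩
        ∑ n (λ x → K x * degree x + (n ∸ 1))
          ≡⟨ trans (∑-+ n _ _) (cong₂ _+_ ∑-KW (∑-const n (n ∸ 1))) ⟩
        3 * b * d + 2 * (e₁ + e₂ + e₃) + n * (n ∸ 1) ∎
        where
        open ≤-Reasoning
        e₁ = At.edges T₁ T₁≤ b
        e₂ = At.edges T₂ T₂≤ b
        e₃ = At.edges T₃ T₃≤ b
        K : ℕ → ℕ
        K x = [ q T₁ x ≺ b ] + [ q T₂ x ≺ b ] + [ q T₃ x ≺ b ]

        convex : ∀ {a w v} → a ≤ 1 → w ≤ v → w + a * v ≤ a * w + v
        convex {zero}  {w} {v} _ w≤v = ≤-trans (≤-reflexive (+-identityʳ w)) w≤v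
        convex {suc zero} {w} {v} _ w≤v = ≤-reflexive (cong₂ _+_ (sym (*-identityˡ w)) (*-identityˡ v))
        convex {suc (suc _)} (s≤s ())

        card : ∀ {T} → T ≤ N → ∑ n (λ x → [ q T x ≺ b ]) ≡ b
        card {T} T≤N = trans (∑-q T (λ i → [ i ≺ b ]) T≤N) (∑-≺ n b b≤n)

        ∑-K : ∑ n K ≡ 3 * b
        ∑-K = trans (∑-+ n _ _) (trans (cong₂ _+_ (trans (∑-+ n _ _) (cong₂ _+_ (card T₁≤) (card T₂≤))) (card T₃≤))
          (triple b))
          where
          triple : ∀ a → a + a + a ≡ 3 * a
          triple = ℕ-Ring.solve-∀

        ∑-KW : ∑ n (λ x → K x * degree x) ≡ 3 * b * d + 2 * (e₁ + e₂ + e₃)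
        ∑-KW = trans (∑-cong n (λ x _ → distrib [ q T₁ x ≺ b ] [ q T₂ x ≺ b ] [ q T₃ x ≺ b ] (degree x)))
          (trans (∑-+ n _ _) (trans (cong₂ _+_ (trans (∑-+ n _ _) (cong₂ _+_
            (∑-degree-prefix T₁ T₁≤ b b≤n b≤k) (∑-degree-prefix T₂ T₂≤ b b≤n b≤k))) (∑-degree-prefix T₃ T₃≤ b b≤n b≤k))
            (collect b d e₁ e₂ e₃)))
          where
          distrib : ∀ a₁ a₂ a₃ w → (a₁ + a₂ + a₃) * w ≡ a₁ * w + a₂ * w + a₃ * w
          distrib = ℕ-Ring.solve-∀
          collect : ∀ b d x y z → b * d + 2 * x + (b * d + 2 * y) + (b * d + 2 * z) ≡ 3 * b * d + 2 * (x + y + z)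
          collect = ℕ-Ring.solve-∀

-- Halfperiods

-- Lookup as a relation on plain numbers, so that positions can be moved by `σ` without bounds in
-- their types.
data _[_]↦_ {A : Set} : List A → ℕ → A → Set where
  here  : ∀ {x xs} → (x ∷ xs) [ 0 ]↦ x
  there : ∀ {x xs i v} → xs [ i ]↦ v → (x ∷ xs) [ suc i ]↦ v

module _ {A : Set} where

  ↦-total : ∀ {xs : List A} {i} → i < length xs → ∃ (xs [ i ]↦_)
  ↦-total {x ∷ xs} {zero}  _   = x , here
  ↦-total {x ∷ xs} {suc i} i<n with ↦-total (s<s⁻¹ i<n)
  ... | v , xs↦v = v , there xs↦v

  ↦⇒∈ : ∀ {xs : List A} {i v} → xs [ i ]↦ v → v ∈ xs
  ↦⇒∈ here      = here refl
  ↦⇒∈ (there w) = there (↦⇒∈ w)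

  ↦-injective : ∀ {xs : List A} {i j v} → Unique xs → xs [ i ]↦ v → xs [ j ]↦ v → i ≡ j
  ↦-injective _        here      here      = refl
  ↦-injective (x∉ ∷ _) here      (there w) = ⊥-elim (lookup x∉ (↦⇒∈ w) refl)
  ↦-injective (x∉ ∷ _) (there w) here      = ⊥-elim (lookup x∉ (↦⇒∈ w) refl)
  ↦-injective (_ ∷ u)  (there w) (there z) = cong suc (↦-injective u w z)

  length-swapAt : ∀ p (xs : List A) → length (swapAt p xs) ≡ length xs
  length-swapAt zero    []           = refl
  length-swapAt zero    (x ∷ [])     = refl
  length-swapAt zero    (x ∷ y ∷ xs) = refl
  length-swapAt (suc p) []           = refl
  length-swapAt (suc p) (x ∷ xs)     = cong suc (length-swapAt p xs)

  ↦-swapAt : ∀ p {xs : List A} {i v} → suc p < length xs → xs [ i ]↦ v → swapAt p xs [ σ p i ]↦ v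
  ↦-swapAt zero    {x ∷ []}     (s≤s ()) _
  ↦-swapAt zero    {x ∷ y ∷ xs} _ here              = there here
  ↦-swapAt zero    {x ∷ y ∷ xs} _ (there here)      = here
  ↦-swapAt zero    {x ∷ y ∷ xs} _ (there (there w)) = there (there w)
  ↦-swapAt (suc p) {x ∷ xs} _ here      = here
  ↦-swapAt (suc p) {x ∷ xs} l (there w) = there (↦-swapAt p (s<s⁻¹ l) w)

  ↦-++ˡ : ∀ {xs ys : List A} {i v} → xs [ i ]↦ v → (xs ++ ys) [ i ]↦ v
  ↦-++ˡ here      = here
  ↦-++ˡ (there w) = there (↦-++ˡ w)

  ↦-++ʳ : ∀ (xs : List A) {ys i v} → ys [ i ]↦ v → (xs ++ ys) [ length xs + i ]↦ v
  ↦-++ʳ []       w = w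
  ↦-++ʳ (x ∷ xs) w = there (↦-++ʳ xs w)

  ↦-reverse : ∀ {xs : List A} {i v} → xs [ i ]↦ v → reverse xs [ length xs ∸ suc i ]↦ v
  ↦-reverse {x ∷ xs} here rewrite unfold-reverse x xs =
    subst (λ z → (reverse xs ++ x ∷ []) [ z ]↦ x) (trans (+-identityʳ _) (length-reverse xs))
      (↦-++ʳ (reverse xs) here)
  ↦-reverse {x ∷ xs} (there w) rewrite unfold-reverse x xs = ↦-++ˡ (↦-reverse w)

  ↦-take : ∀ {m} {xs : List A} {i v} → i < m → xs [ i ]↦ v → v ∈ take m xs
  ↦-take {suc m} _   here      = here refl
  ↦-take {suc m} i<m (there w) = there (↦-take (s<s⁻¹ i<m) w)

  ∈-take : ∀ m {xs : List A} {v} → v ∈ take m xs → ∃ λ i → i < m × xs [ i ]↦ v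
  ∈-take (suc m) {x ∷ xs} (here refl) = 0 , z<s , here
  ∈-take (suc m) {x ∷ xs} (there w) with ∈-take m w
  ... | i , i<m , z = suc i , s<s i<m , there z

  ↦-drop : ∀ m {xs : List A} {i v} → drop m xs [ i ]↦ v → xs [ m + i ]↦ v
  ↦-drop zero    w = w
  ↦-drop (suc m) {x ∷ xs} w = there (↦-drop m w)

  length-filter-applyUpTo : ∀ {P : A → Set} (P? : Decidable P) f N →
    length (filter P? (applyUpTo f N)) ≡ ∑ N (λ u → ⟦ does (P? (f u)) ⟧)
  length-filter-applyUpTo P? f zero = refl
  length-filter-applyUpTo P? f (suc N) with does (P? (f 0))
  ... | true  = cong suc (length-filter-applyUpTo P? (f ∘ suc) N)
  ... | false = length-filter-applyUpTo P? (f ∘ suc) N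

complementary : ∀ {P : Set} (P? : Dec P) {c} → (P → c ≡ 0) → (¬ P → c ≡ 1) → ⟦ does P? ⟧ + c ≡ 1
complementary (yes p) f g = cong suc (f p)
complementary (no ¬p) f g = g ¬p

-- All that the cutting argument uses about edge counts. It stops at `k` vertices since the degree
-- balance `excess` covers only positions up to `k`.
Growth : ℕ → ℕ → (ℕ → ℕ) → Set
Growth d k e = e 0 ≡ 0 × (∀ a h → a + h ≤ k → e (a + h) ≤ a * d + e a + h C 2)

-- The three blocks of a decomposable halfperiod

module Decomposed (m : ℕ) (Π : Halfperiod (3 * m)) (T : ℕ) (T≤N : T ≤ (3 * m) C 2)
  (first≡B : take m (Halfperiod.π Π T) ↭ take m (drop m (Halfperiod.π₀ Π))) where

  open Halfperiod Π
  open Permutationₛ (setoid (Fin (3 * m))) using (Unique-resp-↭)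

  private
    n = 3 * m
    N = n C 2
    p : ℕ → ℕ
    p u = τ u ∸ 1

  suc-p : ∀ u → u < N → suc (p u) ≡ τ u
  suc-p u u<N = m+[n∸m]≡n (proj₁ (τ-range u u<N))

  open Swaps n N p (λ u u<N → ≤-trans (≤-reflexive (cong suc (suc-p u u<N))) (proj₂ (τ-range u u<N)))

  length-π : ∀ t → length (π t) ≡ n
  length-π zero    = trans (↭-length π₀-perm) (length-tabulate id)
  length-π (suc t) = trans (length-swapAt (p t) (π t)) (length-π t)

  unique-π₀ : Unique π₀
  unique-π₀ = Unique-resp-↭ (↭⇒↭ₛ (↭-sym π₀-perm)) (allFin⁺ n)

  ↦-π : ∀ t {x v} → t ≤ N → π₀ [ x ]↦ v → π t [ q t x ]↦ v
  ↦-π zero    _   w = w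
  ↦-π (suc t) t<N w = ↦-swapAt (p t)
    (≤-trans (≤-reflexive (cong suc (suc-p t t<N)))
      (≤-trans (proj₂ (τ-range t t<N)) (≤-reflexive (sym (length-π t)))))
    (↦-π t (<⇒≤ t<N) w)

  π₀-total : ∀ x → x < n → ∃ (π₀ [ x ]↦_)
  π₀-total x x<n = ↦-total (<-≤-trans x<n (≤-reflexive (sym (length-π 0))))

  q-N : ∀ x → x < n → q N x ≡ n ∸ suc x
  q-N x x<n with π₀-total x x<n
  ... | v , w = trans
    (↦-injective unique-reverse (subst (_[ q N x ]↦ v) reversed (↦-π N ≤-refl w)) (↦-reverse w))
    (cong (_∸ suc x) (length-π 0))
    where
    unique-reverse : Unique (reverse π₀)
    unique-reverse = Unique-resp-↭ (↭⇒↭ₛ (↭-sym (↭-reverse π₀))) unique-π₀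

  -- The first `m` elements at time `T` form B, which starts in the middle third.
  q-T : ∀ x → x < n → q T x < m → m ≤ x × x < m + m
  q-T x x<n qx<m with π₀-total x x<n
  ... | v , w with ∈-take m (∈-resp-↭ first≡B (↦-take qx<m (↦-π T T≤N w)))
  ... | i , i<m , z rewrite ↦-injective unique-π₀ w (↦-drop m z) = m≤m+n m i , +-monoʳ-< m i<m

  open Reversing refl q-N

  q-N-late : ∀ x → x < n → q N x < m → m + m ≤ x
  q-N-late x x<n qx<m with <-≤-connex x (m + m)
  ... | inj₂ 2m≤x = 2m≤x
  ... | inj₁ x<2m = ⊥-elim (<⇒≱ qx<m (begin
    m                    ≡⟨ sym (m+n∸n≡m m (m + m)) ⟩
    m + (m + m) ∸ (m + m) ≡⟨ cong (λ z → m + (m + z) ∸ (m + m)) (sym (+-identityʳ m)) ⟩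
    n ∸ (m + m)          ≤⟨ ∸-monoʳ-≤ n x<2m ⟩
    n ∸ suc x            ≡⟨ sym (q-N x x<n) ⟩
    q N x                ∎))
    where open ≤-Reasoning

  -- The prefixes consist of elements of A, B and C respectively, told apart by the third in which
  -- they start.
  disjoint : ∀ b → b ≤ m → ∀ x → x < n → [ q 0 x ≺ b ] + [ q T x ≺ b ] + [ q N x ≺ b ] ≤ 1
  disjoint b b≤m x x<n with <-≤-connex x b | <-≤-connex (q T x) b | <-≤-connex (q N x) b
  ... | inj₁ x<b | inj₁ y<b | _ =
    ⊥-elim (<⇒≱ (<-≤-trans x<b b≤m) (proj₁ (q-T x x<n (<-≤-trans y<b b≤m))))
  ... | inj₁ x<b | inj₂ b≤y | inj₁ z<b =
    ⊥-elim (<⇒≱ (<-≤-trans x<b b≤m) (≤-trans (m≤m+n m m) (q-N-late x x<n (<-≤-trans z<b b≤m))))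
  ... | inj₂ b≤x | inj₁ y<b | inj₁ z<b =
    ⊥-elim (<⇒≱ (proj₂ (q-T x x<n (<-≤-trans y<b b≤m))) (q-N-late x x<n (<-≤-trans z<b b≤m)))
  ... | inj₁ x<b | inj₂ b≤y | inj₂ b≤z rewrite ≺-yes x<b | ≺-no b≤y | ≺-no b≤z = ≤-refl
  ... | inj₂ b≤x | inj₁ y<b | inj₂ b≤z rewrite ≺-no b≤x | ≺-yes y<b | ≺-no b≤z = ≤-refl
  ... | inj₂ b≤x | inj₂ b≤y | _ rewrite ≺-no b≤x | ≺-no b≤y = ⟦⟧≤1 (q N x <ᵇ b)

  -- Counting critical swaps

  module Critical (k d : ℕ) (n≡ : n ≡ suc (k + (k + d))) where

    open Central k d n≡ hiding (module At)
    open Central k d n≡ public using (module At)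

    critical⇒mid≡0 : ∀ u → u < N → LeCritical n k (τ u) → mid u ≡ 0
    critical⇒mid≡0 u u<N (inj₁ τ≤k) =
      trans (cong (_∸ φ (p u)) (φ-early {suc (p u)} (≤-trans (≤-reflexive (suc-p u u<N)) τ≤k))) (0∸n≡0 (φ (p u)))
    critical⇒mid≡0 u u<N (inj₂ n≤τ+k) =
      trans (cong₂ _∸_ (φ-late (≤-trans d+k≤p (n≤1+n (p u)))) (φ-late d+k≤p)) (n∸n≡0 d)
      where
      φ-late : ∀ {i} → d + k ≤ i → φ i ≡ d
      φ-late {i} d+k≤i = m≥n⇒m⊓n≡n (≤-trans (≤-reflexive (sym (m+n∸n≡m d k))) (∸-monoˡ-≤ k d+k≤i))
      d+k≤p : d + k ≤ p u
      d+k≤p = +-cancelˡ-≤ (suc k) _ _ (begin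
        suc k + (d + k)       ≡⟨ cong (λ z → suc (k + z)) (+-comm d k) ⟩
        suc (k + (k + d))     ≡⟨ sym n≡ ⟩
        n                     ≤⟨ n≤τ+k ⟩
        τ u + k               ≡⟨ cong (_+ k) (sym (suc-p u u<N)) ⟩
        suc (p u) + k         ≡⟨ cong suc (+-comm (p u) k) ⟩
        suc k + p u           ∎)
        where open ≤-Reasoning

    central⇒mid≡1 : ∀ u → u < N → ¬ LeCritical n k (τ u) → mid u ≡ 1
    central⇒mid≡1 u u<N ¬critical = begin
      φ (suc (p u)) ∸ φ (p u)       ≡⟨ cong₂ _∸_ (φ-centre p<k+d) (φ-centre (≤-trans (n≤1+n _) p<k+d)) ⟩
      (suc (p u) ∸ k) ∸ (p u ∸ k)   ≡⟨ cong (_∸ (p u ∸ k)) (+-∸-assoc 1 k≤p) ⟩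
      suc (p u ∸ k) ∸ (p u ∸ k)     ≡⟨ m+n∸n≡m 1 (p u ∸ k) ⟩
      1                             ∎
      where
      open ≡-Reasoning
      k≤p : k ≤ p u
      k≤p = s≤s⁻¹ (≤-trans (≰⇒> (¬critical ∘ inj₁)) (≤-reflexive (sym (suc-p u u<N))))
      p<k+d : p u < k + d
      p<k+d = +-cancelˡ-≤ k _ _ (s≤s⁻¹ (≤-trans (s≤s (≤-reflexive (trans
        (+-comm k (suc (p u))) (cong (_+ k) (suc-p u u<N)))))
        (≤-trans (≰⇒> (¬critical ∘ inj₂)) (≤-reflexive n≡))))
      φ-centre : ∀ {i} → i ≤ k + d → φ i ≡ i ∸ k
      φ-centre {i} i≤k+d = m≤n⇒m⊓n≡m (≤-trans (∸-monoˡ-≤ k i≤k+d) (≤-reflexive (m+n∸m≡n k d)))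

    critical+mid : ∀ u → u < N → ⟦ does (leCritical? n k (τ u)) ⟧ + mid u ≡ 1
    critical+mid u u<N = complementary (leCritical? n k (τ u)) (critical⇒mid≡0 u u<N) (central⇒mid≡1 u u<N)

    N≤+mid : N≤ k Π + ∑ N mid ≡ N
    N≤+mid = begin
      N≤ k Π + ∑ N mid
        ≡⟨ cong (_+ ∑ N mid) (length-filter-applyUpTo (λ t → leCritical? n k (τ t)) id N) ⟩
      ∑ N (λ u → ⟦ does (leCritical? n k (τ u)) ⟧) + ∑ N mid
        ≡⟨ sym (∑-+ N _ _) ⟩
      ∑ N (λ u → ⟦ does (leCritical? n k (τ u)) ⟧ + mid u)
        ≡⟨ trans (∑-cong N critical+mid) (trans (∑-const N 1) (*-identityʳ N)) ⟩
      N ∎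
      where open ≡-Reasoning

    e₁ e₂ e₃ : ℕ → ℕ
    e₁ = At.edges 0 z≤n
    e₂ = At.edges T T≤N
    e₃ = At.edges N ≤-refl

    k<n : k < n
    k<n = ≤-trans (s≤s (m≤m+n k (k + d))) (≤-reflexive (sym n≡))

    growth : ∀ t (t≤N : t ≤ N) → Growth d k (At.edges t t≤N)
    growth t t≤N = refl , λ a h a+h≤k → edges-grow a h (≤-trans a+h≤k (<⇒≤ k<n))
      (λ i i<a → ≤-reflexive (excess i (<-trans (i<k a+h≤k i<a) k<n) (<⇒≤ (i<k a+h≤k i<a))))
      where
      open At t t≤N
      i<k : ∀ {a h i} → a + h ≤ k → i < a → i < k
      i<k {a} {h} a+h≤k i<a = <-≤-trans i<a (≤-trans (m≤m+n a h) a+h≤k)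

    -- Complement of `central-bound` in the C(n,2) swaps. As n - 1 is `k + (k + d)`, it amounts to
    -- N≤ ≥ 3 b k - (e₁ b + e₂ b + e₃ b), written without subtraction.
    N≤-lower : ∀ b → b ≤ m → b ≤ k → 3 * b * (k + (k + d)) ≤ 3 * b * d + 2 * (e₁ b + e₂ b + e₃ b) + 2 * N≤ k Π
    N≤-lower b b≤m b≤k = +-cancelˡ-≤ (2 * ∑ N mid) _ _ (begin
      2 * ∑ N mid + 3 * b * (k + (k + d))
        ≡⟨ cong (λ z → 2 * ∑ N mid + 3 * b * z) (sym n∸1) ⟩
      2 * ∑ N mid + 3 * b * (n ∸ 1)
        ≤⟨ central-bound 0 T N z≤n T≤N ≤-refl b (≤-trans b≤k (<⇒≤ k<n)) b≤k (disjoint b b≤m) ⟩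
      X + n * (n ∸ 1)
        ≡⟨ cong (X +_) (trans n[n∸1] (cong (2 *_) (sym N≤+mid))) ⟩
      X + 2 * (N≤ k Π + ∑ N mid)
        ≡⟨ regroup X (N≤ k Π) (∑ N mid) ⟩
      2 * ∑ N mid + (X + 2 * N≤ k Π) ∎)
      where
      open ≤-Reasoning
      X = 3 * b * d + 2 * (e₁ b + e₂ b + e₃ b)
      regroup : ∀ x y z → x + 2 * (y + z) ≡ 2 * z + (x + 2 * y)
      regroup = ℕ-Ring.solve-∀
      n∸1 : n ∸ 1 ≡ k + (k + d)
      n∸1 = cong (_∸ 1) n≡
      n[n∸1] : n * (n ∸ 1) ≡ 2 * N
      n[n∸1] = +-cancelʳ-≡ n _ _ (trans (square n) (sym (2C2 n)))
        where
        square : ∀ a → a * (a ∸ 1) + a ≡ a * a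
        square zero    = refl
        square (suc a) = trans (+-comm (suc a * a) (suc a)) (sym (*-suc (suc a) a))

-- Optimal cuts

open import Data.Integer using (ℤ; +_; 0ℤ; 1ℤ; +≤+) renaming (_+_ to _+ℤ_; _*_ to _*ℤ_; _-_ to _-ℤ_; -_ to -ℤ_; _≤_ to _≤ℤ_)
import Data.Integer.Properties as ℤₚ
import Data.Integer.Tactic.RingSolver as ℤ-Ring
open import Data.Rational using (ℚ; mkℚ; toℚᵘ; 0ℚ; 1ℚ; ½; *≤*; _≤ᵇ_; Positive) renaming (_+_ to _+ℚ_; _*_ to _*ℚ_; _-_ to _-ℚ_; -_ to -ℚ_; _/_ to _/ℚ_)
import Data.Rational.Properties as ℚₚ
import Data.Rational.Unnormalised as ℚᵘ
import Data.Rational.Unnormalised.Properties as ℚᵘₚ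
import Algebra.Properties.Group ℚₚ.+-0-group as ℚ-Group

0≤+ : ∀ {i j} → 0ℤ ≤ℤ i → 0ℤ ≤ℤ j → 0ℤ ≤ℤ i +ℤ j
0≤+ = ℤₚ.+-mono-≤

0≤* : ∀ {i j} → 0ℤ ≤ℤ i → 0ℤ ≤ℤ j → 0ℤ ≤ℤ i *ℤ j
0≤* {+ a} {+ b} _ _ = subst (0ℤ ≤ℤ_) (ℤₚ.pos-* a b) (+≤+ z≤n)

0≤ℕ : ∀ {a} → 0ℤ ≤ℤ + a
0≤ℕ = +≤+ z≤n

0≤-cast : ∀ {a b x y} → a ≤ b → + a ≡ x → + b ≡ y → 0ℤ ≤ℤ y -ℤ x
0≤-cast a≤b refl refl = ℤₚ.i≤j⇒0≤j-i (+≤+ a≤b)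

-- 24 (r + 1) times the excess over e of the edge bound for q vertices that results from
-- cutting them into r + 1 blocks whose sizes grow by d, up to rounding.
slack : ℤ → ℤ → ℤ → ℤ → ℤ
slack r d q e =
  + 12 *ℤ (1ℤ +ℤ r) *ℤ q *ℤ (q -ℤ 1ℤ) +ℤ + 12 *ℤ r *ℤ (1ℤ +ℤ r) *ℤ q *ℤ d -ℤ + 24 *ℤ (1ℤ +ℤ r) *ℤ e
  -ℤ + 12 *ℤ r *ℤ q *ℤ q -ℤ (d *ℤ d -ℤ 1ℤ) *ℤ r *ℤ ((1ℤ +ℤ r) *ℤ (1ℤ +ℤ r)) *ℤ (+ 2 +ℤ r)

-- A single block gives just the trivial bound C(q,2).
slack-base : ∀ d q e → slack 0ℤ d q e ≡ + 12 *ℤ (q *ℤ q -ℤ (+ 2 *ℤ e +ℤ q))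
slack-base = expand
  where
  expand : ∀ d q e →
    + 12 *ℤ (1ℤ +ℤ 0ℤ) *ℤ q *ℤ (q -ℤ 1ℤ) +ℤ + 12 *ℤ 0ℤ *ℤ (1ℤ +ℤ 0ℤ) *ℤ q *ℤ d -ℤ + 24 *ℤ (1ℤ +ℤ 0ℤ) *ℤ e
      -ℤ + 12 *ℤ 0ℤ *ℤ q *ℤ q -ℤ (d *ℤ d -ℤ 1ℤ) *ℤ 0ℤ *ℤ ((1ℤ +ℤ 0ℤ) *ℤ (1ℤ +ℤ 0ℤ)) *ℤ (+ 2 +ℤ 0ℤ)
    ≡ + 12 *ℤ (q *ℤ q -ℤ (+ 2 *ℤ e +ℤ q))
  expand = ℤ-Ring.solve-∀

-- Splits off the last of r + 2 blocks. The summands are the loss in the growth inequality, the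
-- slack of the first `p` vertices, and a rounding term in S = 2 (r + 1) (p + h) + (r + 2) - d (r +
-- 1) (r + 2) - 2 (r + 2) p, which equals r + 2 when `p` is the real optimum.
slack-step : ∀ r d p h e e′ →
  (1ℤ +ℤ r) *ℤ slack (1ℤ +ℤ r) d (p +ℤ h) e ≡
    + 12 *ℤ (1ℤ +ℤ r) *ℤ (+ 2 +ℤ r) *ℤ (+ 2 *ℤ (p *ℤ d) +ℤ + 2 *ℤ e′ +ℤ h *ℤ h -ℤ (+ 2 *ℤ e +ℤ h))
    +ℤ (+ 2 +ℤ r) *ℤ slack r d p e′
    +ℤ + 3 *ℤ (r *ℤ (+ 2 +ℤ r) *ℤ ((+ 2 +ℤ r) *ℤ (+ 2 +ℤ r))
      +ℤ (+ 2 *ℤ (1ℤ +ℤ r) *ℤ (p +ℤ h) +ℤ (+ 2 +ℤ r) -ℤ d *ℤ ((1ℤ +ℤ r) *ℤ (+ 2 +ℤ r)) -ℤ + 2 *ℤ (+ 2 +ℤ r) *ℤ p)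
      *ℤ (+ 2 *ℤ (+ 2 +ℤ r) -ℤ (+ 2 *ℤ (1ℤ +ℤ r) *ℤ (p +ℤ h) +ℤ (+ 2 +ℤ r) -ℤ d *ℤ ((1ℤ +ℤ r) *ℤ (+ 2 +ℤ r)) -ℤ + 2 *ℤ (+ 2 +ℤ r) *ℤ p)))
slack-step = expand
  where
  expand : ∀ r d p h e e′ →
    (1ℤ +ℤ r) *ℤ (+ 12 *ℤ (1ℤ +ℤ (1ℤ +ℤ r)) *ℤ (p +ℤ h) *ℤ ((p +ℤ h) -ℤ 1ℤ) +ℤ + 12 *ℤ (1ℤ +ℤ r) *ℤ (1ℤ +ℤ (1ℤ +ℤ r)) *ℤ (p +ℤ h) *ℤ d -ℤ + 24 *ℤ (1ℤ +ℤ (1ℤ +ℤ r)) *ℤ e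
      -ℤ + 12 *ℤ (1ℤ +ℤ r) *ℤ (p +ℤ h) *ℤ (p +ℤ h) -ℤ (d *ℤ d -ℤ 1ℤ) *ℤ (1ℤ +ℤ r) *ℤ ((1ℤ +ℤ (1ℤ +ℤ r)) *ℤ (1ℤ +ℤ (1ℤ +ℤ r))) *ℤ (+ 2 +ℤ (1ℤ +ℤ r))) ≡
    + 12 *ℤ (1ℤ +ℤ r) *ℤ (+ 2 +ℤ r) *ℤ (+ 2 *ℤ (p *ℤ d) +ℤ + 2 *ℤ e′ +ℤ h *ℤ h -ℤ (+ 2 *ℤ e +ℤ h))
    +ℤ (+ 2 +ℤ r) *ℤ (+ 12 *ℤ (1ℤ +ℤ r) *ℤ p *ℤ (p -ℤ 1ℤ) +ℤ + 12 *ℤ r *ℤ (1ℤ +ℤ r) *ℤ p *ℤ d -ℤ + 24 *ℤ (1ℤ +ℤ r) *ℤ e′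
        -ℤ + 12 *ℤ r *ℤ p *ℤ p -ℤ (d *ℤ d -ℤ 1ℤ) *ℤ r *ℤ ((1ℤ +ℤ r) *ℤ (1ℤ +ℤ r)) *ℤ (+ 2 +ℤ r))
    +ℤ + 3 *ℤ (r *ℤ (+ 2 +ℤ r) *ℤ ((+ 2 +ℤ r) *ℤ (+ 2 +ℤ r))
      +ℤ (+ 2 *ℤ (1ℤ +ℤ r) *ℤ (p +ℤ h) +ℤ (+ 2 +ℤ r) -ℤ d *ℤ ((1ℤ +ℤ r) *ℤ (+ 2 +ℤ r)) -ℤ + 2 *ℤ (+ 2 +ℤ r) *ℤ p)
      *ℤ (+ 2 *ℤ (+ 2 +ℤ r) -ℤ (+ 2 *ℤ (1ℤ +ℤ r) *ℤ (p +ℤ h) +ℤ (+ 2 +ℤ r) -ℤ d *ℤ ((1ℤ +ℤ r) *ℤ (+ 2 +ℤ r)) -ℤ + 2 *ℤ (+ 2 +ℤ r) *ℤ p)))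
  expand = ℤ-Ring.solve-∀

isolate : ∀ {a b c s} → a + b + c ≡ s → + a ≡ + s -ℤ + c -ℤ + b
isolate {a} {b} {c} refl = undo (+ a) (+ b) (+ c)
  where
  undo : ∀ x y z → x ≡ x +ℤ y +ℤ z -ℤ z -ℤ y
  undo = ℤ-Ring.solve-∀

module _ (d k : ℕ) (1≤d : 1 ≤ d) (e : ℕ → ℕ) (growth : Growth d k e) where

  growth₂ : ∀ a h → a + h ≤ k → 2 * e (a + h) + h ≤ 2 * (a * d) + 2 * e a + h * h
  growth₂ a h a+h≤k = begin
    2 * e (a + h) + h                ≤⟨ +-monoˡ-≤ h (*-monoʳ-≤ 2 (proj₂ growth a h a+h≤k)) ⟩
    2 * (a * d + e a + h C 2) + h    ≡⟨ expand (a * d) (e a) (h C 2) h ⟩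
    2 * (a * d) + 2 * e a + (2 * (h C 2) + h)  ≡⟨ cong (λ z → 2 * (a * d) + 2 * e a + z) (2C2 h) ⟩
    2 * (a * d) + 2 * e a + h * h    ∎
    where
    open ≤-Reasoning
    expand : ∀ x y z h → 2 * (x + y + z) + h ≡ 2 * x + 2 * y + (2 * z + h)
    expand = ℕ-Ring.solve-∀

  2e+q≤q² : ∀ q → q ≤ k → 2 * e q + q ≤ q * q
  2e+q≤q² q q≤k = ≤-trans (growth₂ 0 q q≤k) (≤-reflexive (cong (λ z → 2 * z + q * q) (proj₁ growth)))

  -- Here `s` is the S of `slack-step`. From 0 ≤ S ≤ 2 (r + 2) the product S (2 (r + 2) - S) is
  -- nonnegative, and with it the rounding term.
  slack-cut : ∀ r p h s → p + h ≤ k →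
    s + p * (2 * (2 + r)) + d * ((1 + r) * (2 + r)) ≡ 2 * (1 + r) * (p + h) + (2 + r) → s ≤ 2 * (2 + r) →
    0ℤ ≤ℤ slack (+ r) (+ d) (+ p) (+ e p) → 0ℤ ≤ℤ slack (+ suc r) (+ d) (+ (p + h)) (+ e (p + h))
  slack-cut r p h s p+h≤k s-eq s≤2g ih = ℤₚ.*-cancelˡ-≤-pos 0ℤ _ (+ suc r)
    (subst₂ _≤ℤ_ (sym (ℤₚ.*-zeroʳ (+ suc r))) (sym (slack-step (+ r) (+ d) (+ p) (+ h) (+ e (p + h)) (+ e p)))
      (0≤+ (0≤+
        (0≤* (0≤* {+ 12 *ℤ + suc r} {+ suc (suc r)} 0≤ℕ 0≤ℕ) (0≤-cast (growth₂ p h p+h≤k)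
          (cong (_+ℤ + h) (ℤₚ.pos-* 2 (e (p + h))))
          (cong₂ _+ℤ_ (cong₂ _+ℤ_ (trans (ℤₚ.pos-* 2 (p * d)) (cong (+ 2 *ℤ_) (ℤₚ.pos-* p d))) (ℤₚ.pos-* 2 (e p)))
            (ℤₚ.pos-* h h))))
        (0≤* {+ suc (suc r)} 0≤ℕ ih))
        (0≤* {+ 3} 0≤ℕ (0≤+
          (0≤* (0≤* {+ r} {+ suc (suc r)} 0≤ℕ 0≤ℕ) (0≤* {+ suc (suc r)} {+ suc (suc r)} 0≤ℕ 0≤ℕ))
          (0≤* (subst (0ℤ ≤ℤ_) s≡ 0≤ℕ) (0≤-cast s≤2g s≡ (ℤₚ.pos-* 2 (2 + r))))))))
    where
    s≡ : + s ≡ + 2 *ℤ (1ℤ +ℤ + r) *ℤ (+ p +ℤ + h) +ℤ (+ 2 +ℤ + r) -ℤ + d *ℤ ((1ℤ +ℤ + r) *ℤ (+ 2 +ℤ + r)) -ℤ + 2 *ℤ (+ 2 +ℤ + r) *ℤ + p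
    s≡ = trans (isolate s-eq) (cong₂ _-ℤ_ (cong₂ _-ℤ_
      (cong (_+ℤ + suc (suc r)) (trans (ℤₚ.pos-* (2 * suc r) (p + h)) (cong (_*ℤ + (p + h)) (ℤₚ.pos-* 2 (suc r)))))
      (trans (ℤₚ.pos-* d _) (cong (+ d *ℤ_) (ℤₚ.pos-* (suc r) (suc (suc r))))))
      (trans (ℤₚ.pos-* p _) (trans (ℤₚ.*-comm (+ p) _) (cong (_*ℤ + p) (ℤₚ.pos-* 2 (suc (suc r)))))))

  -- The last cut p is the real optimum R q / (R + 1) - d R / 2, rounded.
  slack-nonneg : ∀ r q → q ≤ k → d * (r * suc r) ≤ 2 * q → 0ℤ ≤ℤ slack (+ r) (+ d) (+ q) (+ e q)
  slack-nonneg zero q q≤k _ = subst (0ℤ ≤ℤ_) (sym (slack-base (+ d) (+ q) (+ e q)))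
    (0≤* {+ 12} 0≤ℕ (0≤-cast (2e+q≤q² q q≤k) (cong (_+ℤ + q) (ℤₚ.pos-* 2 (e q))) (ℤₚ.pos-* q q)))
  slack-nonneg (suc r) q q≤k small = subst (λ q → 0ℤ ≤ℤ slack (+ suc r) (+ d) (+ q) (+ e q)) (m+[n∸m]≡n p≤q)
    (slack-cut r p (q ∸ p) s (≤-trans (≤-reflexive (m+[n∸m]≡n p≤q)) q≤k)
      (trans division (cong (λ z → 2 * R * z + g) (sym (m+[n∸m]≡n p≤q))))
      (<⇒≤ s<2g) (slack-nonneg r p (≤-trans p≤q q≤k) p-large))
    where
    R = suc r
    g = suc R
    -- Adding `g` turns the floor of division by `2 * g` into rounding to the nearest integer.
    X = 2 * R * q + g ∸ d * (R * g)
    p = X / (2 * g)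
    s = X % (2 * g)
    s<2g : s < 2 * g
    s<2g = m%n<n X (2 * g)
    2q≤ : 2 * q ≤ 2 * R * q
    2q≤ = *-monoˡ-≤ q (*-monoʳ-≤ 2 (s≤s (z≤n {r})))
    -- The truncated subtraction in `X` is exact because d R g ≤ 2 q ≤ 2 R q.
    division : s + p * (2 * g) + d * (R * g) ≡ 2 * R * q + g
    division = trans (cong (_+ d * (R * g)) (sym (m≡m%n+[m/n]*n X (2 * g))))
      (m∸n+n≡m (≤-trans small (≤-trans 2q≤ (m≤m+n _ g))))
    -- By `1 ≤ d` the subtracted `d * (R * g)` is at least `g`, so rounding cannot push the cut
    -- beyond `q`.
    p≤q : p ≤ q
    p≤q = *-cancelʳ-≤ p q (2 * g) (+-cancelʳ-≤ g _ _ (begin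
      p * (2 * g) + g                       ≤⟨ +-mono-≤ (m≤n+m _ s) g≤dRg ⟩
      s + p * (2 * g) + d * (R * g)         ≡⟨ division ⟩
      2 * R * q + g                         ≤⟨ +-monoˡ-≤ g (*-monoˡ-≤ q (*-monoʳ-≤ 2 (n≤1+n R))) ⟩
      2 * g * q + g                         ≡⟨ cong (_+ g) (*-comm (2 * g) q) ⟩
      q * (2 * g) + g                       ∎))
      where
      open ≤-Reasoning
      g≤dRg : g ≤ d * (R * g)
      g≤dRg = ≤-trans (≤-trans (m≤m+n g (r * g)) (≤-reflexive (sym (*-identityˡ (R * g))))) (*-monoˡ-≤ (R * g) 1≤d)
    -- The hypothesis `small` says that the smallest block has nonnegative real size, and it passes
    -- to the blocks before the cut. Rounding loses less than 1 from `2 * p`, which integrality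
    -- absorbs.
    p-large : d * (r * R) ≤ 2 * p
    p-large = s≤s⁻¹ (s≤s⁻¹ (*-cancelˡ-< g _ _ (+-cancelʳ-< (d * (R * g)) _ _ (begin-strict
      g * suc (d * (r * R)) + d * (R * g)    ≡⟨ collect d r ⟩
      d * (R * g) * R + g                    ≤⟨ +-monoˡ-≤ g (*-monoˡ-≤ R small) ⟩
      2 * q * R + g                          ≡⟨ cong (_+ g) (reorder q R) ⟩
      2 * R * q + g                          ≡⟨ sym division ⟩
      s + p * (2 * g) + d * (R * g)          <⟨ +-monoˡ-< (d * (R * g)) (+-monoˡ-< (p * (2 * g)) s<2g) ⟩
      2 * g + p * (2 * g) + d * (R * g)      ≡⟨ cong (_+ d * (R * g)) (factor g p) ⟩
      g * suc (suc (2 * p)) + d * (R * g)    ∎))))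
      where
      open ≤-Reasoning
      collect : ∀ d r → (2 + r) * (1 + d * (r * (1 + r))) + d * ((1 + r) * (2 + r)) ≡ d * ((1 + r) * (2 + r)) * (1 + r) + (2 + r)
      collect = ℕ-Ring.solve-∀
      reorder : ∀ q R → 2 * q * R ≡ 2 * R * q
      reorder = ℕ-Ring.solve-∀
      factor : ∀ g p → 2 * g + p * (2 * g) ≡ g * (2 + 2 * p)
      factor = ℕ-Ring.solve-∀

-- Rational arithmetic

ℚ-ring : AlmostCommutativeRing _ _
ℚ-ring = fromCommutativeRing ℚₚ.+-*-commutativeRing (λ _ → nothing)

opaque

  -- The embedding of the integers, opaque so that later proofs rest on its homomorphism laws and
  -- not on normalised fractions.
  fromℤ : ℤ → ℚ
  fromℤ z = z /ℚ 1

  fromℤ≡mkℚ : ∀ z → fromℤ z ≡ mkℚ z 0 (coprime-sym (1-coprimeTo _))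
  fromℤ≡mkℚ z = ℚₚ.fromℚᵘ-toℚᵘ (mkℚ z 0 (coprime-sym (1-coprimeTo _)))

  fromℤ-+ : ∀ a b → fromℤ (a +ℤ b) ≡ fromℤ a +ℚ fromℤ b
  fromℤ-+ a b = trans (cong fromℤ (sym (cong₂ _+ℤ_ (ℤₚ.*-identityʳ a) (ℤₚ.*-identityʳ b))))
    (sym (cong₂ _+ℚ_ (fromℤ≡mkℚ a) (fromℤ≡mkℚ b)))

  fromℤ-* : ∀ a b → fromℤ (a *ℤ b) ≡ fromℤ a *ℚ fromℤ b
  fromℤ-* a b = sym (cong₂ _*ℚ_ (fromℤ≡mkℚ a) (fromℤ≡mkℚ b))

  fromℤ-neg : ∀ a → fromℤ (-ℤ a) ≡ -ℚ fromℤ a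
  fromℤ-neg a = ℚ-Group.inverseʳ-unique (fromℤ a) (fromℤ (-ℤ a))
    (trans (sym (fromℤ-+ a (-ℤ a))) (cong fromℤ (ℤₚ.+-inverseʳ a)))

  fromℤ-- : ∀ a b → fromℤ (a -ℤ b) ≡ fromℤ a -ℚ fromℤ b
  fromℤ-- a b = trans (fromℤ-+ a (-ℤ b)) (cong (fromℤ a +ℚ_) (fromℤ-neg b))

  fromℤ-mono : ∀ {a b} → a ≤ℤ b → fromℤ a ≤ℚ fromℤ b
  fromℤ-mono {a} {b} a≤b = subst₂ _≤ℚ_ (sym (fromℤ≡mkℚ a)) (sym (fromℤ≡mkℚ b))
    (*≤* (subst₂ _≤ℤ_ (sym (ℤₚ.*-identityʳ a)) (sym (ℤₚ.*-identityʳ b)) a≤b))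

  fromℤ-cancel : ∀ {a b} → fromℤ a ≤ℚ fromℤ b → a ≤ℤ b
  fromℤ-cancel {a} {b} a≤b with subst₂ _≤ℚ_ (fromℤ≡mkℚ a) (fromℤ≡mkℚ b) a≤b
  ... | *≤* a1≤b1 = subst₂ _≤ℤ_ (ℤₚ.*-identityʳ a) (ℤₚ.*-identityʳ b) a1≤b1

  positive-ℕ : ∀ c .{{_ : NonZero c}} → Positive (fromℤ (+ c))
  positive-ℕ c = ℚₚ.normalize-pos c 1

  *-cancelˡ-≤-ℕ : ∀ c .{{_ : NonZero c}} {x y} → fromℤ (+ c) *ℚ x ≤ℚ fromℤ (+ c) *ℚ y → x ≤ℚ y
  *-cancelˡ-≤-ℕ c = ℚₚ.*-cancelˡ-≤-pos (fromℤ (+ c)) {{positive-ℕ c}}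

  *-cancelˡ-≡-ℕ : ∀ c .{{_ : NonZero c}} {x y} → fromℤ (+ c) *ℚ x ≡ fromℤ (+ c) *ℚ y → x ≡ y
  *-cancelˡ-≡-ℕ c eq =
    ℚₚ.≤-antisym (*-cancelˡ-≤-ℕ c (ℚₚ.≤-reflexive eq)) (*-cancelˡ-≤-ℕ c (ℚₚ.≤-reflexive (sym eq)))

  -- Carried out on unnormalised fractions, where no common factor has been cancelled and cross
  -- multiplication suffices.
  /-*-cancel : ∀ z c .{{_ : NonZero c}} → (z /ℚ c) *ℚ fromℤ (+ c) ≡ fromℤ z
  /-*-cancel z (suc c) = ℚₚ.toℚᵘ-injective (begin
    toℚᵘ ((z /ℚ suc c) *ℚ fromℤ (+ suc c))            ≈⟨ ℚₚ.toℚᵘ-homo-* (z /ℚ suc c) (fromℤ (+ suc c)) ⟩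
    toℚᵘ (z /ℚ suc c) ℚᵘ.* toℚᵘ (fromℤ (+ suc c))  ≈⟨ ℚᵘₚ.*-cong (ℚₚ.toℚᵘ-fromℚᵘ (ℚᵘ.mkℚᵘ z c)) (ℚₚ.toℚᵘ-fromℚᵘ (ℚᵘ.mkℚᵘ (+ suc c) 0)) ⟩
    ℚᵘ.mkℚᵘ z c ℚᵘ.* ℚᵘ.mkℚᵘ (+ suc c) 0                 ≈⟨ ℚᵘ.*≡* cross ⟩
    ℚᵘ.mkℚᵘ z 0                                          ≈⟨ ℚₚ.toℚᵘ-fromℚᵘ (ℚᵘ.mkℚᵘ z 0) ⟨
    toℚᵘ (fromℤ z)                                    ∎)
    where
    open SetoidReasoning ℚᵘₚ.≃-setoid
    cross : z *ℤ + suc c *ℤ 1ℤ ≡ z *ℤ + (suc c * 1)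
    cross = trans (ℤₚ.*-assoc z (+ suc c) 1ℤ) (cong (z *ℤ_) (sym (ℤₚ.pos-* (suc c) 1)))

  fromℤ-ℕ : ∀ n → ℕtoℚ n ≡ fromℤ (+ n)
  fromℤ-ℕ n = refl

  fromℤ-0 : fromℤ 0ℤ ≡ 0ℚ
  fromℤ-0 = refl

  fromℤ-1 : fromℤ 1ℤ ≡ 1ℚ
  fromℤ-1 = refl

  2*½≡1 : fromℤ (+ 2) *ℚ ½ ≡ 1ℚ
  2*½≡1 = refl


binomQ-above : ∀ x → fromℤ (+ 2) ≤ℚ x → binomQ x ≡ x *ℚ (x -ℚ 1ℚ) *ℚ ½
binomQ-above x 2≤x with ℕtoℚ 2 ≤ᵇ x | ℚₚ.≤⇒≤ᵇ (subst (_≤ℚ x) (sym (fromℤ-ℕ 2)) 2≤x)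
... | true | _ = refl

binomQ-below : ∀ x → ¬ fromℤ (+ 2) ≤ℚ x → binomQ x ≡ 0ℚ
binomQ-below x 2≰x with ℕtoℚ 2 ≤ᵇ x | ℚₚ.≤ᵇ⇒≤ {ℕtoℚ 2} {x}
... | true  | 2≤x = ⊥-elim (2≰x (subst (_≤ℚ x) (fromℤ-ℕ 2) (2≤x _)))
... | false | _   = refl

module _ (c : ℕ) .{{_ : NonZero c}} (x : ℚ) (X : ℤ) (cx≡X : fromℤ (+ c) *ℚ x ≡ fromℤ X) where

  binomQ-scaled : + c *ℤ + 2 ≤ℤ X → fromℤ (+ 2 *ℤ (+ c *ℤ + c)) *ℚ binomQ x ≡ fromℤ (X *ℤ (X -ℤ + c))
  binomQ-scaled 2c≤X = begin
    fromℤ (+ 2 *ℤ (+ c *ℤ + c)) *ℚ binomQ x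
      ≡⟨ cong₂ _*ℚ_ (trans (fromℤ-* (+ 2) (+ c *ℤ + c)) (cong (t *ℚ_) (fromℤ-* (+ c) (+ c)))) (binomQ-above x 2≤x) ⟩
    t *ℚ (ĉ *ℚ ĉ) *ℚ (x *ℚ (x -ℚ 1ℚ) *ℚ ½)
      ≡⟨ regroup (t) ĉ x 1ℚ ½ ⟩
    t *ℚ ½ *ℚ (ĉ *ℚ x *ℚ (ĉ *ℚ x -ℚ ĉ *ℚ 1ℚ))
      ≡⟨ trans (cong (_*ℚ (ĉ *ℚ x *ℚ (ĉ *ℚ x -ℚ ĉ *ℚ 1ℚ))) 2*½≡1) (ℚₚ.*-identityˡ _) ⟩
    ĉ *ℚ x *ℚ (ĉ *ℚ x -ℚ ĉ *ℚ 1ℚ)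
      ≡⟨ cong₂ (λ y z → y *ℚ (y -ℚ z)) cx≡X (ℚₚ.*-identityʳ ĉ) ⟩
    fromℤ X *ℚ (fromℤ X -ℚ ĉ)
      ≡⟨ sym (trans (fromℤ-* X (X -ℤ + c)) (cong (fromℤ X *ℚ_) (fromℤ-- X (+ c)))) ⟩
    fromℤ (X *ℤ (X -ℤ + c)) ∎
    where
    open ≡-Reasoning
    ĉ = fromℤ (+ c)
    t = fromℤ (+ 2)
    2≤x : fromℤ (+ 2) ≤ℚ x
    2≤x = *-cancelˡ-≤-ℕ c (subst₂ _≤ℚ_ (fromℤ-* (+ c) (+ 2)) (sym cx≡X) (fromℤ-mono 2c≤X))
    regroup : ∀ t c x o h → t *ℚ (c *ℚ c) *ℚ (x *ℚ (x -ℚ o) *ℚ h) ≡ t *ℚ h *ℚ (c *ℚ x *ℚ (c *ℚ x -ℚ c *ℚ o))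
    regroup = solve-∀ ℚ-ring

  binomQ-zero : ¬ + c *ℤ + 2 ≤ℤ X → binomQ x ≡ 0ℚ
  binomQ-zero 2c≰X = binomQ-below x (λ 2≤x → 2c≰X (fromℤ-cancel (subst₂ _≤ℚ_
    (sym (fromℤ-* (+ c) (+ 2))) cx≡X (ℚₚ.*-monoˡ-≤-nonNeg (fromℤ (+ c)) {{ℚₚ.pos⇒nonNeg (fromℤ (+ c)) {{positive-ℕ c}}}} 2≤x))))

fromℤ-*-assoc : ∀ a b w → fromℤ (a *ℤ b) *ℚ w ≡ fromℤ a *ℚ (fromℤ b *ℚ w)
fromℤ-*-assoc a b w = trans (cong (_*ℚ w) (fromℤ-* a b)) (ℚₚ.*-assoc (fromℤ a) (fromℤ b) w)

fromℤ-linear : ∀ a b x y → fromℤ (a *ℤ (b *ℤ x) -ℤ a *ℤ y +ℤ b *ℤ y) ≡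
  fromℤ a *ℚ (fromℤ b *ℚ fromℤ x) -ℚ fromℤ a *ℚ fromℤ y +ℚ fromℤ b *ℚ fromℤ y
fromℤ-linear a b x y = trans (fromℤ-+ (a *ℤ (b *ℤ x) -ℤ a *ℤ y) (b *ℤ y)) (cong₂ _+ℚ_
  (trans (fromℤ-- (a *ℤ (b *ℤ x)) (a *ℤ y)) (cong₂ _-ℚ_
    (trans (fromℤ-* a (b *ℤ x)) (cong (fromℤ a *ℚ_) (fromℤ-* b x)))
    (fromℤ-* a y)))
  (fromℤ-* b y))

-- One step of a sum over changing denominators: the old sum `z` has scale `b′`, the new term `t`
-- has scale `c`, and both are brought to `a *ℤ b`.
fromℤ-add : ∀ a b a′ b′ c v w {z t} → a *ℤ b ≡ a′ *ℤ b′ → a *ℤ b ≡ c →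
  fromℤ b′ *ℚ z ≡ fromℤ v → fromℤ c *ℚ t ≡ fromℤ w →
  fromℤ a *ℚ (fromℤ b *ℚ (z +ℚ t)) ≡ fromℤ (a′ *ℤ v +ℤ w)
fromℤ-add a b a′ b′ c v w {z} {t} eq₁ eq₂ z-eq t-eq = begin
  fromℤ a *ℚ (fromℤ b *ℚ (z +ℚ t))
    ≡⟨ sym (fromℤ-*-assoc a b (z +ℚ t)) ⟩
  fromℤ (a *ℤ b) *ℚ (z +ℚ t)
    ≡⟨ ℚₚ.*-distribˡ-+ (fromℤ (a *ℤ b)) z t ⟩
  fromℤ (a *ℤ b) *ℚ z +ℚ fromℤ (a *ℤ b) *ℚ t
    ≡⟨ cong₂ (λ x y → fromℤ x *ℚ z +ℚ fromℤ y *ℚ t) eq₁ eq₂ ⟩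
  fromℤ (a′ *ℤ b′) *ℚ z +ℚ fromℤ c *ℚ t
    ≡⟨ cong₂ _+ℚ_ (trans (fromℤ-*-assoc a′ b′ z) (cong (fromℤ a′ *ℚ_) z-eq)) t-eq ⟩
  fromℤ a′ *ℚ fromℤ v +ℚ fromℤ w
    ≡⟨ sym (trans (fromℤ-+ (a′ *ℤ v) w) (cong (_+ℚ fromℤ w) (fromℤ-* a′ v))) ⟩
  fromℤ (a′ *ℤ v +ℤ w) ∎
  where open ≡-Reasoning

-- The sum over 2 ≤ j ≤ c + 1 of its polynomial terms, times 24 (c + 2).
closed : ℤ → ℤ → ℤ → ℤ
closed m d c =
  + 12 *ℤ (1ℤ +ℤ c) *ℤ m *ℤ m -ℤ + 12 *ℤ (1ℤ +ℤ c) *ℤ (+ 2 +ℤ c) *ℤ m *ℤ d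
  +ℤ (d *ℤ d -ℤ 1ℤ) *ℤ (1ℤ +ℤ c) *ℤ ((+ 2 +ℤ c) *ℤ (+ 2 +ℤ c)) *ℤ (+ 3 +ℤ c)
  -ℤ + 6 *ℤ (+ 2 +ℤ c) *ℤ ((m -ℤ d) *ℤ (m -ℤ d) -ℤ 1ℤ)

closed-zero : ∀ m d → closed m d 0ℤ ≡ 0ℤ
closed-zero = expand
  where
  expand : ∀ m d →
    + 12 *ℤ (1ℤ +ℤ 0ℤ) *ℤ m *ℤ m -ℤ + 12 *ℤ (1ℤ +ℤ 0ℤ) *ℤ (+ 2 +ℤ 0ℤ) *ℤ m *ℤ d
    +ℤ (d *ℤ d -ℤ 1ℤ) *ℤ (1ℤ +ℤ 0ℤ) *ℤ ((+ 2 +ℤ 0ℤ) *ℤ (+ 2 +ℤ 0ℤ)) *ℤ (+ 3 +ℤ 0ℤ)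
    -ℤ + 6 *ℤ (+ 2 +ℤ 0ℤ) *ℤ ((m -ℤ d) *ℤ (m -ℤ d) -ℤ 1ℤ) ≡ 0ℤ
  expand = ℤ-Ring.solve-∀

-- Both sides have the common scale 72 (c + 2) (c + 3). The last summand is the new term, at j = c +
-- 2, in the form given by `term-active`.
closed-suc : ∀ m d c → + 3 *ℤ (+ 2 +ℤ c) *ℤ closed m d (1ℤ +ℤ c) ≡
  + 3 *ℤ (+ 3 +ℤ c) *ℤ closed m d c
  +ℤ + 9 *ℤ ((+ 2 *ℤ m -ℤ d *ℤ ((+ 2 +ℤ c) *ℤ (+ 3 +ℤ c))) *ℤ (+ 2 *ℤ m -ℤ d *ℤ ((+ 2 +ℤ c) *ℤ (+ 3 +ℤ c)))
    -ℤ ((+ 2 +ℤ c) *ℤ (+ 3 +ℤ c)) *ℤ ((+ 2 +ℤ c) *ℤ (+ 3 +ℤ c)))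
closed-suc = expand
  where
  expand : ∀ m d c →
    + 3 *ℤ (+ 2 +ℤ c) *ℤ
      (+ 12 *ℤ (1ℤ +ℤ (1ℤ +ℤ c)) *ℤ m *ℤ m -ℤ + 12 *ℤ (1ℤ +ℤ (1ℤ +ℤ c)) *ℤ (+ 2 +ℤ (1ℤ +ℤ c)) *ℤ m *ℤ d
      +ℤ (d *ℤ d -ℤ 1ℤ) *ℤ (1ℤ +ℤ (1ℤ +ℤ c)) *ℤ ((+ 2 +ℤ (1ℤ +ℤ c)) *ℤ (+ 2 +ℤ (1ℤ +ℤ c))) *ℤ (+ 3 +ℤ (1ℤ +ℤ c))
      -ℤ + 6 *ℤ (+ 2 +ℤ (1ℤ +ℤ c)) *ℤ ((m -ℤ d) *ℤ (m -ℤ d) -ℤ 1ℤ)) ≡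
    + 3 *ℤ (+ 3 +ℤ c) *ℤ
      (+ 12 *ℤ (1ℤ +ℤ c) *ℤ m *ℤ m -ℤ + 12 *ℤ (1ℤ +ℤ c) *ℤ (+ 2 +ℤ c) *ℤ m *ℤ d
      +ℤ (d *ℤ d -ℤ 1ℤ) *ℤ (1ℤ +ℤ c) *ℤ ((+ 2 +ℤ c) *ℤ (+ 2 +ℤ c)) *ℤ (+ 3 +ℤ c)
      -ℤ + 6 *ℤ (+ 2 +ℤ c) *ℤ ((m -ℤ d) *ℤ (m -ℤ d) -ℤ 1ℤ))
    +ℤ + 9 *ℤ ((+ 2 *ℤ m -ℤ d *ℤ ((+ 2 +ℤ c) *ℤ (+ 3 +ℤ c))) *ℤ (+ 2 *ℤ m -ℤ d *ℤ ((+ 2 +ℤ c) *ℤ (+ 3 +ℤ c)))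
      -ℤ ((+ 2 +ℤ c) *ℤ (+ 3 +ℤ c)) *ℤ ((+ 2 +ℤ c) *ℤ (+ 3 +ℤ c)))
  expand = ℤ-Ring.solve-∀

-- The factor j (j + 1) at j = i + 2, the offset used in `term`.
J : ℕ → ℕ
J i = (2 + i) * (3 + i)

-- The sum in the bound: nonvanishing terms and closed form

module Terms (m k d : ℕ) (n≡ : 3 * m ≡ suc (k + (k + d))) where

  private
    n = 3 * m
    M = + m
    K = + k
    D = + d

  D≡ : D ≡ + 3 *ℤ M -ℤ 1ℤ -ℤ + 2 *ℤ K
  D≡ = trans (cancel K D) (cong (λ z → z -ℤ 1ℤ -ℤ + 2 *ℤ K) (trans (cong +_ (sym n≡)) (ℤₚ.pos-* 3 m)))
    where
    cancel : ∀ K D → D ≡ (1ℤ +ℤ (K +ℤ (K +ℤ D))) -ℤ 1ℤ -ℤ + 2 *ℤ K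
    cancel = ℤ-Ring.solve-∀

  argument : ℕ → ℚ
  argument i = ℕtoℚ (k + 1) -ℚ cTimesN i n

  -- Numerator of `argument i` over `6 * J i`, with `k` eliminated through n = 2 k + 1 + d.
  scaled : ℕ → ℤ
  scaled i = + 3 *ℤ (+ 2 *ℤ M +ℤ + J i -ℤ D *ℤ + J i)

  argument-scaled : ∀ i → fromℤ (+ (6 * J i)) *ℚ argument i ≡ fromℤ (scaled i)
  argument-scaled i = begin
    fromℤ (+ (6 * J i)) *ℚ (ℕtoℚ (k + 1) -ℚ (v -ℚ w))
      ≡⟨ cong (λ y → fromℤ (+ (6 * J i)) *ℚ (y -ℚ (v -ℚ w))) (fromℤ-ℕ (k + 1)) ⟩
    fromℤ (+ (6 * J i)) *ℚ (u -ℚ (v -ℚ w))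
      ≡⟨ cong (_*ℚ (u -ℚ (v -ℚ w))) (trans (cong (fromℤ ∘ +_) (six (J i))) (trans (cong fromℤ (ℤₚ.pos-* (3 * J i) 2)) (fromℤ-* (+ (3 * J i)) (+ 2)))) ⟩
    s *ℚ t *ℚ (u -ℚ (v -ℚ w))
      ≡⟨ regroup s t u v w ⟩
    s *ℚ (t *ℚ u) -ℚ s *ℚ (v *ℚ t) +ℚ t *ℚ (w *ℚ s)
      ≡⟨ cong₂ (λ y z → s *ℚ (t *ℚ u) -ℚ s *ℚ y +ℚ t *ℚ z) (/-*-cancel (+ n) 2)
           (trans (cong (λ z → w *ℚ fromℤ (+ z)) (sym (*-assoc 3 (2 + i) (3 + i)))) (/-*-cancel (+ n) (3 * (2 + i) * (3 + i)))) ⟩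
    s *ℚ (t *ℚ u) -ℚ s *ℚ fromℤ (+ n) +ℚ t *ℚ fromℤ (+ n)
      ≡⟨ sym (fromℤ-linear (+ (3 * J i)) (+ 2) (+ (k + 1)) (+ n)) ⟩
    fromℤ (+ (3 * J i) *ℤ (+ 2 *ℤ + (k + 1)) -ℤ + (3 * J i) *ℤ + n +ℤ + 2 *ℤ + n)
      ≡⟨ cong fromℤ (trans (cong₂ (λ y z → y *ℤ (+ 2 *ℤ (K +ℤ 1ℤ)) -ℤ y *ℤ z +ℤ + 2 *ℤ z) (ℤₚ.pos-* 3 (J i)) (ℤₚ.pos-* 3 m))
           (trans (simplify M K (+ J i)) (cong (λ z → + 3 *ℤ (+ 2 *ℤ M +ℤ + J i -ℤ z *ℤ + J i)) (sym D≡)))) ⟩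
    fromℤ (scaled i) ∎
    where
    open ≡-Reasoning
    u = fromℤ (+ (k + 1))
    v = + n /ℚ 2
    w = + n /ℚ (3 * (2 + i) * (3 + i))
    s = fromℤ (+ (3 * J i))
    t = fromℤ (+ 2)
    six : ∀ j → 6 * j ≡ 3 * j * 2
    six j = trans (*-assoc 3 2 j) (trans (cong (3 *_) (*-comm 2 j)) (sym (*-assoc 3 j 2)))
    regroup : ∀ s t u v w → s *ℚ t *ℚ (u -ℚ (v -ℚ w)) ≡ s *ℚ (t *ℚ u) -ℚ s *ℚ (v *ℚ t) +ℚ t *ℚ (w *ℚ s)
    regroup = solve-∀ ℚ-ring
    simplify : ∀ M K j → + 3 *ℤ j *ℤ (+ 2 *ℤ (K +ℤ 1ℤ)) -ℤ + 3 *ℤ j *ℤ (+ 3 *ℤ M) +ℤ + 2 *ℤ (+ 3 *ℤ M) ≡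
      + 3 *ℤ (+ 2 *ℤ M +ℤ j -ℤ (+ 3 *ℤ M -ℤ 1ℤ -ℤ + 2 *ℤ K) *ℤ j)
    simplify = ℤ-Ring.solve-∀

  -- Integer form of the condition that `argument i` reaches the cutoff 2 of the binomial.
  Active : ℕ → Set
  Active i = (d + 3) * J i ≤ 2 * m

  scaled-threshold : ∀ i → scaled i -ℤ + (6 * J i) *ℤ + 2 ≡ + 3 *ℤ (+ (2 * m) -ℤ + ((d + 3) * J i))
  scaled-threshold i = begin
    scaled i -ℤ + (6 * J i) *ℤ + 2
      ≡⟨ cong (λ z → scaled i -ℤ z *ℤ + 2) (ℤₚ.pos-* 6 (J i)) ⟩
    scaled i -ℤ + 6 *ℤ + J i *ℤ + 2
      ≡⟨ simplify M D (+ J i) ⟩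
    + 3 *ℤ (+ 2 *ℤ M -ℤ (D +ℤ + 3) *ℤ + J i)
      ≡⟨ cong₂ (λ y z → + 3 *ℤ (y -ℤ z)) (sym (ℤₚ.pos-* 2 m)) (sym (ℤₚ.pos-* (d + 3) (J i))) ⟩
    + 3 *ℤ (+ (2 * m) -ℤ + ((d + 3) * J i)) ∎
    where
    open ≡-Reasoning
    simplify : ∀ M D j → + 3 *ℤ (+ 2 *ℤ M +ℤ j -ℤ D *ℤ j) -ℤ + 6 *ℤ j *ℤ + 2 ≡ + 3 *ℤ (+ 2 *ℤ M -ℤ (D +ℤ + 3) *ℤ j)
    simplify = ℤ-Ring.solve-∀

  active⇒above : ∀ i → Active i → + (6 * J i) *ℤ + 2 ≤ℤ scaled i
  active⇒above i active = ℤₚ.0≤i-j⇒j≤i (subst (0ℤ ≤ℤ_) (sym (scaled-threshold i))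
    (0≤* {+ 3} 0≤ℕ (0≤-cast active refl refl)))

  above⇒active : ∀ i → + (6 * J i) *ℤ + 2 ≤ℤ scaled i → Active i
  above⇒active i above = ℤₚ.drop‿+≤+ (ℤₚ.0≤i-j⇒j≤i (ℤₚ.*-cancelˡ-≤-pos 0ℤ _ (+ 3)
    (subst (0ℤ ≤ℤ_) (scaled-threshold i) (ℤₚ.i≤j⇒0≤j-i above))))

  term-inactive : ∀ i → ¬ Active i → term k n i ≡ 0ℚ
  term-inactive i inactive = trans
    (cong (ℕtoℚ (J i) *ℚ_) (binomQ-zero (6 * J i) (argument i) (scaled i) (argument-scaled i) (inactive ∘ above⇒active i)))
    (ℚₚ.*-zeroʳ (ℕtoℚ (J i)))

  -- For X = `scaled i` and J = `J i`, the product X (X - 6 J) is a difference of squares: X = 3 ((2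
  -- m - d J) + J) and X - 6 J = 3 ((2 m - d J) - J).
  term-active : ∀ i → Active i → fromℤ (+ 72 *ℤ + J i) *ℚ term k n i ≡
    fromℤ (+ 9 *ℤ ((+ 2 *ℤ M -ℤ D *ℤ + J i) *ℤ (+ 2 *ℤ M -ℤ D *ℤ + J i) -ℤ + J i *ℤ + J i))
  term-active i active = begin
    fromℤ (+ 72 *ℤ + J i) *ℚ (ℕtoℚ (J i) *ℚ binomQ (argument i))
      ≡⟨ cong (λ y → fromℤ (+ 72 *ℤ + J i) *ℚ (y *ℚ binomQ (argument i))) (fromℤ-ℕ (J i)) ⟩
    fromℤ (+ 72 *ℤ + J i) *ℚ (fromℤ (+ J i) *ℚ binomQ (argument i))
      ≡⟨ sym (fromℤ-*-assoc (+ 72 *ℤ + J i) (+ J i) _) ⟩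
    fromℤ (+ 72 *ℤ + J i *ℤ + J i) *ℚ binomQ (argument i)
      ≡⟨ cong (λ z → fromℤ z *ℚ binomQ (argument i)) (trans (square (+ J i)) (cong (λ z → + 2 *ℤ (z *ℤ z)) (sym (ℤₚ.pos-* 6 (J i))))) ⟩
    fromℤ (+ 2 *ℤ (+ (6 * J i) *ℤ + (6 * J i))) *ℚ binomQ (argument i)
      ≡⟨ binomQ-scaled (6 * J i) (argument i) (scaled i) (argument-scaled i) (active⇒above i active) ⟩
    fromℤ (scaled i *ℤ (scaled i -ℤ + (6 * J i)))
      ≡⟨ cong fromℤ (trans (cong (λ z → scaled i *ℤ (scaled i -ℤ z)) (ℤₚ.pos-* 6 (J i))) (difference M D (+ J i))) ⟩
    fromℤ (+ 9 *ℤ ((+ 2 *ℤ M -ℤ D *ℤ + J i) *ℤ (+ 2 *ℤ M -ℤ D *ℤ + J i) -ℤ + J i *ℤ + J i)) ∎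
    where
    open ≡-Reasoning
    square : ∀ j → + 72 *ℤ j *ℤ j ≡ + 2 *ℤ (+ 6 *ℤ j *ℤ (+ 6 *ℤ j))
    square = ℤ-Ring.solve-∀
    difference : ∀ M D j → + 3 *ℤ (+ 2 *ℤ M +ℤ j -ℤ D *ℤ j) *ℤ (+ 3 *ℤ (+ 2 *ℤ M +ℤ j -ℤ D *ℤ j) -ℤ + 6 *ℤ j) ≡
      + 9 *ℤ ((+ 2 *ℤ M -ℤ D *ℤ j) *ℤ (+ 2 *ℤ M -ℤ D *ℤ j) -ℤ j *ℤ j)
    difference = ℤ-Ring.solve-∀

  sumTerms-inactive : ∀ c → (∀ i → ¬ Active i) → sumTerms k n c ≡ 0ℚ
  sumTerms-inactive zero    inactive = refl
  sumTerms-inactive (suc c) inactive = cong₂ _+ℚ_ (sumTerms-inactive c inactive) (term-inactive c (inactive c))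

  sumTerms-active : ∀ c → (∀ i → i < c → Active i) →
    fromℤ (+ 24 *ℤ (+ 2 +ℤ + c)) *ℚ sumTerms k n c ≡ fromℤ (closed M D (+ c))
  sumTerms-active zero    active = trans (ℚₚ.*-zeroʳ (fromℤ (+ 48))) (trans (sym fromℤ-0) (cong fromℤ (sym (closed-zero M D))))
  sumTerms-active (suc c) active = *-cancelˡ-≡-ℕ (3 * (2 + c)) (begin
    fromℤ (+ (3 * (2 + c))) *ℚ (fromℤ (+ 24 *ℤ (+ 3 +ℤ + c)) *ℚ (z +ℚ t))
      ≡⟨ cong (λ y → fromℤ y *ℚ (fromℤ (+ 24 *ℤ (+ 3 +ℤ + c)) *ℚ (z +ℚ t))) (ℤₚ.pos-* 3 (2 + c)) ⟩
    fromℤ (+ 3 *ℤ (+ 2 +ℤ + c)) *ℚ (fromℤ (+ 24 *ℤ (+ 3 +ℤ + c)) *ℚ (z +ℚ t))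
      ≡⟨ fromℤ-add (+ 3 *ℤ (+ 2 +ℤ + c)) (+ 24 *ℤ (+ 3 +ℤ + c)) (+ 3 *ℤ (+ 3 +ℤ + c)) (+ 24 *ℤ (+ 2 +ℤ + c)) (+ 72 *ℤ + J c)
           (closed M D (+ c)) (increment (+ J c)) (shift (+ c)) (trans (merge (+ c)) (cong (+ 72 *ℤ_) (sym J≡)))
           (sumTerms-active c (λ i i<c → active i (m<n⇒m<1+n i<c))) (term-active c (active c ≤-refl)) ⟩
    fromℤ (+ 3 *ℤ (+ 3 +ℤ + c) *ℤ closed M D (+ c) +ℤ increment (+ J c))
      ≡⟨ cong fromℤ (trans (cong (λ y → + 3 *ℤ (+ 3 +ℤ + c) *ℤ closed M D (+ c) +ℤ increment y) J≡) (sym (closed-suc M D (+ c)))) ⟩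
    fromℤ (+ 3 *ℤ (+ 2 +ℤ + c) *ℤ closed M D (+ suc c))
      ≡⟨ trans (fromℤ-* (+ 3 *ℤ (+ 2 +ℤ + c)) (closed M D (+ suc c))) (cong (λ y → fromℤ y *ℚ fromℤ (closed M D (+ suc c))) (sym (ℤₚ.pos-* 3 (2 + c)))) ⟩
    fromℤ (+ (3 * (2 + c))) *ℚ fromℤ (closed M D (+ suc c)) ∎)
    where
    open ≡-Reasoning
    z = sumTerms k n c
    t = term k n c
    increment : ℤ → ℤ
    increment j = + 9 *ℤ ((+ 2 *ℤ M -ℤ D *ℤ j) *ℤ (+ 2 *ℤ M -ℤ D *ℤ j) -ℤ j *ℤ j)
    J≡ : + J c ≡ (+ 2 +ℤ + c) *ℤ (+ 3 +ℤ + c)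
    J≡ = ℤₚ.pos-* (2 + c) (3 + c)
    shift : ∀ c → + 3 *ℤ (+ 2 +ℤ c) *ℤ (+ 24 *ℤ (+ 3 +ℤ c)) ≡ + 3 *ℤ (+ 3 +ℤ c) *ℤ (+ 24 *ℤ (+ 2 +ℤ c))
    shift = ℤ-Ring.solve-∀
    merge : ∀ c → + 3 *ℤ (+ 2 +ℤ c) *ℤ (+ 24 *ℤ (+ 3 +ℤ c)) ≡ + 72 *ℤ ((+ 2 +ℤ c) *ℤ (+ 3 +ℤ c))
    merge = ℤ-Ring.solve-∀

  Closed : ℕ → ℕ → Set
  Closed c c′ = fromℤ (+ 24 *ℤ (+ 2 +ℤ + c′)) *ℚ sumTerms k n c ≡ fromℤ (closed M D (+ c′))

  -- Here `c′` falls behind `c` once terms vanish. The inequality is what `slack-nonneg` requires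
  -- for r = c′ + 1 and q = m.
  ClosedSum : ℕ → Set
  ClosedSum c = ∃ λ c′ → d * (suc c′ * suc (suc c′)) ≤ 2 * m × Closed c c′

  -- Later terms have smaller arguments, so the active terms form an initial segment.
  sumTerms-closed : d ≤ m → ∀ c → ClosedSum c
  sumTerms-closed d≤m zero = 0 , ≤-trans (*-monoˡ-≤ 2 d≤m) (≤-reflexive (*-comm m 2)) , sumTerms-active 0 (λ i ())
  sumTerms-closed d≤m (suc c) = extend ((d + 3) * J c ≤? 2 * m) (sumTerms-closed d≤m c)
    where
    extend : Dec (Active c) → ClosedSum c → ClosedSum (suc c)
    -- As `J` is increasing, all earlier terms are active too, so the closed form covers `suc c`
    -- terms; weakening `d + 3` to `d` leaves the required inequality.
    extend (yes active) _ = suc c , ≤-trans (*-monoˡ-≤ (J c) (m≤m+n d 3)) active ,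
      sumTerms-active (suc c) (λ i i≤c → ≤-trans
        (*-monoʳ-≤ (d + 3) (*-mono-≤ (+-monoʳ-≤ 2 (s≤s⁻¹ i≤c)) (+-monoʳ-≤ 3 (s≤s⁻¹ i≤c)))) active)
    extend (no inactive) (c′ , small , eq) = c′ , small , trans
      (cong (fromℤ (+ 24 *ℤ (+ 2 +ℤ + c′)) *ℚ_)
        (trans (cong (sumTerms k n c +ℚ_) (term-inactive c inactive)) (ℚₚ.+-identityʳ (sumTerms k n c)))) eq

-- Scaling the bound to integers

one* : ∀ x → fromℤ 1ℤ *ℚ x ≡ x
one* x = trans (cong (_*ℚ x) fromℤ-1) (ℚₚ.*-identityˡ x)

-- The cutoff sits at 2, but the polynomial vanishes at 1 as well, so it is already correct there.
binomQ-ℤ : ∀ X → 1ℤ ≤ℤ X → fromℤ (+ 2) *ℚ binomQ (fromℤ X) ≡ fromℤ (X *ℤ (X -ℤ 1ℤ))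
binomQ-ℤ (+ 1) _ = trans
  (cong (fromℤ (+ 2) *ℚ_) (binomQ-zero 1 (fromℤ 1ℤ) 1ℤ (one* (fromℤ 1ℤ)) (λ { (+≤+ (s≤s ())) })))
  (trans (ℚₚ.*-zeroʳ (fromℤ (+ 2))) (sym fromℤ-0))
binomQ-ℤ (+ suc (suc x)) _ =
  binomQ-scaled 1 (fromℤ (+ suc (suc x))) (+ suc (suc x)) (one* (fromℤ (+ suc (suc x)))) (+≤+ (s≤s (s≤s z≤n)))
binomQ-ℤ (+ 0) (+≤+ ())

binomQ-ℤ-zero : ∀ X → X ≤ℤ 0ℤ → binomQ (fromℤ X) ≡ 0ℚ
binomQ-ℤ-zero X X≤0 = binomQ-zero 1 (fromℤ X) X (one* (fromℤ X)) (λ 2≤X → two≰zero (ℤₚ.≤-trans 2≤X X≤0))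
  where
  two≰zero : ¬ + 2 ≤ℤ 0ℤ
  two≰zero (+≤+ ())

fromℤ-bound : ∀ G a₁ a₂ a₃ {b₁ b₂ b₃} →
  fromℤ (+ 2) *ℚ b₁ ≡ fromℤ a₁ → fromℤ (+ 2) *ℚ b₂ ≡ fromℤ a₂ → fromℤ G *ℚ b₃ ≡ fromℤ a₃ →
  fromℤ (+ 2 *ℤ G) *ℚ (fromℤ (+ 3) *ℚ b₁ +ℚ fromℤ (+ 3) *ℚ b₂ +ℚ fromℤ (+ 3) *ℚ b₃) ≡
  fromℤ (G *ℤ + 3 *ℤ (a₁ +ℤ a₂) +ℤ + 6 *ℤ a₃)
fromℤ-bound G a₁ a₂ a₃ {b₁} {b₂} {b₃} eq₁ eq₂ eq₃ = begin
  fromℤ (+ 2 *ℤ G) *ℚ (h *ℚ b₁ +ℚ h *ℚ b₂ +ℚ h *ℚ b₃)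
    ≡⟨ cong (_*ℚ (h *ℚ b₁ +ℚ h *ℚ b₂ +ℚ h *ℚ b₃)) (fromℤ-* (+ 2) G) ⟩
  t *ℚ g *ℚ (h *ℚ b₁ +ℚ h *ℚ b₂ +ℚ h *ℚ b₃)
    ≡⟨ regroup t g h b₁ b₂ b₃ ⟩
  g *ℚ h *ℚ (t *ℚ b₁ +ℚ t *ℚ b₂) +ℚ t *ℚ h *ℚ (g *ℚ b₃)
    ≡⟨ cong₂ _+ℚ_ (cong (g *ℚ h *ℚ_) (cong₂ _+ℚ_ eq₁ eq₂)) (cong₂ _*ℚ_ (sym (fromℤ-* (+ 2) (+ 3))) eq₃) ⟩
  g *ℚ h *ℚ (fromℤ a₁ +ℚ fromℤ a₂) +ℚ fromℤ (+ 6) *ℚ fromℤ a₃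
    ≡⟨ sym (trans (fromℤ-+ (G *ℤ + 3 *ℤ (a₁ +ℤ a₂)) (+ 6 *ℤ a₃)) (cong₂ _+ℚ_
         (trans (fromℤ-* (G *ℤ + 3) (a₁ +ℤ a₂)) (cong₂ _*ℚ_ (fromℤ-* G (+ 3)) (fromℤ-+ a₁ a₂)))
         (fromℤ-* (+ 6) a₃))) ⟩
  fromℤ (G *ℤ + 3 *ℤ (a₁ +ℤ a₂) +ℤ + 6 *ℤ a₃) ∎
  where
  open ≡-Reasoning
  t = fromℤ (+ 2)
  g = fromℤ G
  h = fromℤ (+ 3)
  regroup : ∀ t g h x y z → t *ℚ g *ℚ (h *ℚ x +ℚ h *ℚ y +ℚ h *ℚ z) ≡ g *ℚ h *ℚ (t *ℚ x +ℚ t *ℚ y) +ℚ t *ℚ h *ℚ (g *ℚ z)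
  regroup = solve-∀ ℚ-ring

-- With G = 24 (c + 2), the left side is 2 G times the difference between N≤ and the bound. The
-- right side is G times the slack in `N≤-lower` at b = m plus twice the three slacks for r = c + 1,
-- all of them nonnegative.
combination : ∀ M K c E₁ E₂ E₃ N D → D ≡ + 3 *ℤ M -ℤ 1ℤ -ℤ + 2 *ℤ K →
  + 2 *ℤ (+ 24 *ℤ (+ 2 +ℤ c)) *ℤ N
    -ℤ (+ 24 *ℤ (+ 2 +ℤ c) *ℤ + 3 *ℤ ((K +ℤ 1ℤ) *ℤ (K +ℤ 1ℤ -ℤ 1ℤ) +ℤ (K +ℤ 1ℤ -ℤ M) *ℤ (K +ℤ 1ℤ -ℤ M -ℤ 1ℤ)) +ℤ + 6 *ℤ closed M D c) ≡
  + 24 *ℤ (+ 2 +ℤ c) *ℤ (+ 3 *ℤ M *ℤ D +ℤ + 2 *ℤ (E₁ +ℤ E₂ +ℤ E₃) +ℤ + 2 *ℤ N -ℤ + 3 *ℤ M *ℤ (K +ℤ (K +ℤ D)))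
    +ℤ + 2 *ℤ (slack (1ℤ +ℤ c) D M E₁ +ℤ slack (1ℤ +ℤ c) D M E₂ +ℤ slack (1ℤ +ℤ c) D M E₃)
combination M K c E₁ E₂ E₃ N _ refl = expand M K c E₁ E₂ E₃ N
  where
  expand : ∀ M K c E₁ E₂ E₃ N → let
      D = + 3 *ℤ M -ℤ 1ℤ -ℤ + 2 *ℤ K
      quadratic = + 12 *ℤ (1ℤ +ℤ (1ℤ +ℤ c)) *ℤ M *ℤ (M -ℤ 1ℤ) +ℤ + 12 *ℤ (1ℤ +ℤ c) *ℤ (1ℤ +ℤ (1ℤ +ℤ c)) *ℤ M *ℤ D
      remainder = + 12 *ℤ (1ℤ +ℤ c) *ℤ M *ℤ M
      constant = (D *ℤ D -ℤ 1ℤ) *ℤ (1ℤ +ℤ c) *ℤ ((1ℤ +ℤ (1ℤ +ℤ c)) *ℤ (1ℤ +ℤ (1ℤ +ℤ c))) *ℤ (+ 2 +ℤ (1ℤ +ℤ c))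
    in
    + 2 *ℤ (+ 24 *ℤ (+ 2 +ℤ c)) *ℤ N
      -ℤ (+ 24 *ℤ (+ 2 +ℤ c) *ℤ + 3 *ℤ ((K +ℤ 1ℤ) *ℤ (K +ℤ 1ℤ -ℤ 1ℤ) +ℤ (K +ℤ 1ℤ -ℤ M) *ℤ (K +ℤ 1ℤ -ℤ M -ℤ 1ℤ)) +ℤ + 6 *ℤ
        (+ 12 *ℤ (1ℤ +ℤ c) *ℤ M *ℤ M -ℤ + 12 *ℤ (1ℤ +ℤ c) *ℤ (+ 2 +ℤ c) *ℤ M *ℤ D
        +ℤ (D *ℤ D -ℤ 1ℤ) *ℤ (1ℤ +ℤ c) *ℤ ((+ 2 +ℤ c) *ℤ (+ 2 +ℤ c)) *ℤ (+ 3 +ℤ c)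
        -ℤ + 6 *ℤ (+ 2 +ℤ c) *ℤ ((M -ℤ D) *ℤ (M -ℤ D) -ℤ 1ℤ))) ≡
    + 24 *ℤ (+ 2 +ℤ c) *ℤ (+ 3 *ℤ M *ℤ D +ℤ + 2 *ℤ (E₁ +ℤ E₂ +ℤ E₃) +ℤ + 2 *ℤ N -ℤ + 3 *ℤ M *ℤ (K +ℤ (K +ℤ D)))
      +ℤ + 2 *ℤ ((quadratic -ℤ + 24 *ℤ (1ℤ +ℤ (1ℤ +ℤ c)) *ℤ E₁ -ℤ remainder -ℤ constant)
        +ℤ (quadratic -ℤ + 24 *ℤ (1ℤ +ℤ (1ℤ +ℤ c)) *ℤ E₂ -ℤ remainder -ℤ constant)
        +ℤ (quadratic -ℤ + 24 *ℤ (1ℤ +ℤ (1ℤ +ℤ c)) *ℤ E₃ -ℤ remainder -ℤ constant))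
  expand = ℤ-Ring.solve-∀

-- Comparison of N≤ with the bound

module _ (m : ℕ) (Π : Halfperiod (3 * m)) (T : ℕ) (T≤N : T ≤ (3 * m) C 2)
  (first≡B : take m (Halfperiod.π Π T) ↭ take m (drop m (Halfperiod.π₀ Π)))
  (k d : ℕ) (1≤d : 1 ≤ d) (n≡ : 3 * m ≡ suc (k + (k + d))) where

  open Decomposed m Π T T≤N first≡B
  open Critical k d n≡
  open Terms m k d n≡

  private
    n = 3 * m
    Nk = N≤ k Π

  ℕtoℚ-shift : ℕtoℚ (k + 1) -ℚ ℕtoℚ (n / 3) ≡ fromℤ (+ k +ℤ 1ℤ -ℤ + m)
  ℕtoℚ-shift = trans (cong (λ z → ℕtoℚ (k + 1) -ℚ ℕtoℚ z) (trans (cong (_/ 3) (*-comm 3 m)) (m*n/n≡m m 3)))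
    (trans (cong₂ _-ℚ_ (fromℤ-ℕ (k + 1)) (fromℤ-ℕ m)) (sym (fromℤ-- (+ (k + 1)) (+ m))))

  binomQ-first : fromℤ (+ 2) *ℚ binomQ (ℕtoℚ (k + 1)) ≡ fromℤ ((+ k +ℤ 1ℤ) *ℤ (+ k +ℤ 1ℤ -ℤ 1ℤ))
  binomQ-first = trans (cong (λ z → fromℤ (+ 2) *ℚ binomQ z) (fromℤ-ℕ (k + 1))) (binomQ-ℤ (+ k +ℤ 1ℤ) (+≤+ (m≤n+m 1 k)))

  Bound-fromℤ : ∀ s → Bound k n s ≡ fromℤ (+ 3) *ℚ binomQ (ℕtoℚ (k + 1))
    +ℚ fromℤ (+ 3) *ℚ binomQ (ℕtoℚ (k + 1) -ℚ ℕtoℚ (n / 3)) +ℚ fromℤ (+ 3) *ℚ sumTerms k n (s ∸ 2)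
  Bound-fromℤ s = cong (λ h → h *ℚ binomQ (ℕtoℚ (k + 1)) +ℚ h *ℚ binomQ (ℕtoℚ (k + 1) -ℚ ℕtoℚ (n / 3)) +ℚ h *ℚ sumTerms k n (s ∸ 2))
    (fromℤ-ℕ 3)

  Bound≤ : ∀ c .{{_ : NonZero c}} G s a₁ a₂ a₃ → + c ≡ + 2 *ℤ G →
    fromℤ (+ 2) *ℚ binomQ (ℕtoℚ (k + 1)) ≡ fromℤ a₁ →
    fromℤ (+ 2) *ℚ binomQ (ℕtoℚ (k + 1) -ℚ ℕtoℚ (n / 3)) ≡ fromℤ a₂ →
    fromℤ G *ℚ sumTerms k n (s ∸ 2) ≡ fromℤ a₃ →
    0ℤ ≤ℤ + 2 *ℤ G *ℤ + Nk -ℤ (G *ℤ + 3 *ℤ (a₁ +ℤ a₂) +ℤ + 6 *ℤ a₃) → Bound k n s ≤ℚ ℕtoℚ Nk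
  Bound≤ c G s a₁ a₂ a₃ c≡2G eq₁ eq₂ eq₃ le = subst₂ _≤ℚ_ (sym (Bound-fromℤ s)) (sym (fromℤ-ℕ Nk))
    (*-cancelˡ-≤-ℕ c (subst (λ z → fromℤ z *ℚ b ≤ℚ fromℤ z *ℚ fromℤ (+ Nk)) (sym c≡2G)
      (subst₂ _≤ℚ_ (sym (fromℤ-bound G a₁ a₂ a₃ eq₁ eq₂ eq₃)) (fromℤ-* (+ 2 *ℤ G) (+ Nk))
        (fromℤ-mono (ℤₚ.0≤i-j⇒j≤i le)))))
    where
    b = fromℤ (+ 3) *ℚ binomQ (ℕtoℚ (k + 1)) +ℚ fromℤ (+ 3) *ℚ binomQ (ℕtoℚ (k + 1) -ℚ ℕtoℚ (n / 3))
      +ℚ fromℤ (+ 3) *ℚ sumTerms k n (s ∸ 2)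

  -- Only the first binomial of the bound survives. The prefixes have length `b = k`, and the
  -- trivial estimate C(k,2) for each edge count suffices.
  bound-small : k < m → ∀ s → Bound k n s ≤ℚ ℕtoℚ Nk
  bound-small k<m s = Bound≤ 2 1ℤ s ((+ k +ℤ 1ℤ) *ℤ (+ k +ℤ 1ℤ -ℤ 1ℤ)) 0ℤ 0ℤ refl
    binomQ-first
    (vanish (fromℤ (+ 2)) (trans (cong binomQ ℕtoℚ-shift)
      (binomQ-ℤ-zero (+ k +ℤ 1ℤ -ℤ + m) (ℤₚ.i≤j⇒i-j≤0 (+≤+ (≤-trans (≤-reflexive (+-comm k 1)) k<m))))))
    (vanish (fromℤ 1ℤ) (sumTerms-inactive (s ∸ 2) inactive))
    (0≤-cast lower (cast-square (+ k) (ℤₚ.pos-* 3 ((k + 1) * k)) (ℤₚ.pos-* (k + 1) k)) (ℤₚ.pos-* 2 Nk))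
    where
    vanish : ∀ a {b} → b ≡ 0ℚ → a *ℚ b ≡ fromℤ 0ℤ
    vanish a b≡0 = trans (cong (a *ℚ_) b≡0) (trans (ℚₚ.*-zeroʳ a) (sym fromℤ-0))
    cast-square : ∀ K {x y} → x ≡ + 3 *ℤ y → y ≡ (K +ℤ 1ℤ) *ℤ K →
      x ≡ 1ℤ *ℤ + 3 *ℤ ((K +ℤ 1ℤ) *ℤ (K +ℤ 1ℤ -ℤ 1ℤ) +ℤ 0ℤ) +ℤ + 6 *ℤ 0ℤ
    cast-square K refl refl = expand K
      where
      expand : ∀ K → + 3 *ℤ ((K +ℤ 1ℤ) *ℤ K) ≡ 1ℤ *ℤ + 3 *ℤ ((K +ℤ 1ℤ) *ℤ (K +ℤ 1ℤ -ℤ 1ℤ) +ℤ 0ℤ) +ℤ + 6 *ℤ 0ℤ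
      expand = ℤ-Ring.solve-∀
    -- The centre is then longer than `m`, too long for any `Active i`.
    m<d : m < d
    m<d = +-cancelˡ-≤ (2 * m) _ _ (begin
      2 * m + suc m             ≡⟨ expand m ⟩
      suc (3 * m)               ≡⟨ cong suc n≡ ⟩
      suc (suc (k + (k + d)))   ≡⟨ collect k d ⟩
      2 * suc k + d             ≤⟨ +-monoˡ-≤ d (*-monoʳ-≤ 2 k<m) ⟩
      2 * m + d                 ∎)
      where
      open ≤-Reasoning
      expand : ∀ m → 2 * m + (1 + m) ≡ 1 + 3 * m
      expand = ℕ-Ring.solve-∀
      collect : ∀ k d → 2 + (k + (k + d)) ≡ 2 * (1 + k) + d
      collect = ℕ-Ring.solve-∀
    inactive : ∀ i → ¬ Active i
    inactive i active = <⇒≱ m<d (≤-trans (m≤m+n d 3) (*-cancelʳ-≤ (d + 3) m 2 (≤-trans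
      (*-monoʳ-≤ (d + 3) (s≤s (s≤s (z≤n {suc (i + suc i * (3 + i))})))) (≤-trans active (≤-reflexive (*-comm 2 m))))))
    lower : 3 * ((k + 1) * k) ≤ 2 * Nk
    lower = +-cancelˡ-≤ (3 * k * d + 3 * (k * k)) _ _ (begin
      3 * k * d + 3 * (k * k) + 3 * ((k + 1) * k)
        ≡⟨ expand k d ⟩
      3 * k * (k + (k + d)) + 3 * k
        ≤⟨ +-monoˡ-≤ (3 * k) (N≤-lower k (<⇒≤ k<m) ≤-refl) ⟩
      3 * k * d + 2 * (e₁ k + e₂ k + e₃ k) + 2 * Nk + 3 * k
        -- Spreading `3 * k` over the three edge counts matches the form of `2e+q≤q²`.
        ≡⟨ distribute (3 * k * d) (e₁ k) (e₂ k) (e₃ k) (2 * Nk) k ⟩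
      3 * k * d + ((2 * e₁ k + k) + (2 * e₂ k + k) + (2 * e₃ k + k)) + 2 * Nk
        ≤⟨ +-monoˡ-≤ (2 * Nk) (+-monoʳ-≤ (3 * k * d) (+-mono-≤ (+-mono-≤ (square z≤n) (square T≤N)) (square ≤-refl))) ⟩
      3 * k * d + (k * k + k * k + k * k) + 2 * Nk
        ≡⟨ cong (λ z → 3 * k * d + z + 2 * Nk) (triple (k * k)) ⟩
      3 * k * d + 3 * (k * k) + 2 * Nk ∎)
      where
      open ≤-Reasoning
      square : ∀ {t} (t≤N : t ≤ n C 2) → 2 * At.edges t t≤N k + k ≤ k * k
      square {t} t≤N = 2e+q≤q² d k 1≤d (At.edges t t≤N) (growth t t≤N) k ≤-refl
      expand : ∀ k d → 3 * k * d + 3 * (k * k) + 3 * ((k + 1) * k) ≡ 3 * k * (k + (k + d)) + 3 * k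
      expand = ℕ-Ring.solve-∀
      distribute : ∀ a x y z b k → a + 2 * (x + y + z) + b + 3 * k ≡ a + ((2 * x + k) + (2 * y + k) + (2 * z + k)) + b
      distribute = ℕ-Ring.solve-∀
      triple : ∀ a → a + a + a ≡ 3 * a
      triple = ℕ-Ring.solve-∀

  -- The prefixes are now the whole blocks A, B and C, so `b = m`. Each edge count is bounded by
  -- cutting into c + 2 blocks, with `c` supplied by `sumTerms-closed`.
  bound-large : m ≤ k → ∀ s → Bound k n s ≤ℚ ℕtoℚ Nk
  bound-large m≤k s = conclude (sumTerms-closed d≤m (s ∸ 2))
    where
    d≤m : d ≤ m
    d≤m = +-cancelˡ-≤ (2 * m) _ _ (begin
      2 * m + d             ≤⟨ +-monoˡ-≤ d (*-monoʳ-≤ 2 m≤k) ⟩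
      2 * k + d             ≤⟨ n≤1+n _ ⟩
      suc (2 * k + d)       ≡⟨ collect k d ⟩
      suc (k + (k + d))     ≡⟨ sym n≡ ⟩
      3 * m                 ≡⟨ +-comm m (2 * m) ⟩
      2 * m + m             ∎)
      where
      open ≤-Reasoning
      collect : ∀ k d → 1 + (2 * k + d) ≡ 1 + (k + (k + d))
      collect = ℕ-Ring.solve-∀
    1≤k+1-m : 1ℤ ≤ℤ + k +ℤ 1ℤ -ℤ + m
    1≤k+1-m = subst (1ℤ ≤ℤ_) (reorder (+ k) (+ m)) (ℤₚ.+-monoʳ-≤ 1ℤ (ℤₚ.i≤j⇒0≤j-i (+≤+ m≤k)))
      where
      reorder : ∀ K M → 1ℤ +ℤ (K -ℤ M) ≡ K +ℤ 1ℤ -ℤ M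
      reorder = ℤ-Ring.solve-∀
    lhs-cast : + (3 * m * (k + (k + d))) ≡ + 3 *ℤ + m *ℤ (+ k +ℤ (+ k +ℤ + d))
    lhs-cast = trans (ℤₚ.pos-* (3 * m) (k + (k + d))) (cong (_*ℤ + (k + (k + d))) (ℤₚ.pos-* 3 m))
    rhs-cast : + (3 * m * d + 2 * (e₁ m + e₂ m + e₃ m) + 2 * Nk) ≡
      + 3 *ℤ + m *ℤ + d +ℤ + 2 *ℤ (+ e₁ m +ℤ + e₂ m +ℤ + e₃ m) +ℤ + 2 *ℤ + Nk
    rhs-cast = cong₂ _+ℤ_ (cong₂ _+ℤ_
      (trans (ℤₚ.pos-* (3 * m) d) (cong (_*ℤ + d) (ℤₚ.pos-* 3 m))) (ℤₚ.pos-* 2 (e₁ m + e₂ m + e₃ m))) (ℤₚ.pos-* 2 Nk)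
    conclude : ClosedSum (s ∸ 2) → Bound k n s ≤ℚ ℕtoℚ Nk
    conclude (c , small , sum≡) = Bound≤ (2 * (24 * (2 + c))) (+ 24 *ℤ (+ 2 +ℤ + c)) s
      ((+ k +ℤ 1ℤ) *ℤ (+ k +ℤ 1ℤ -ℤ 1ℤ)) ((+ k +ℤ 1ℤ -ℤ + m) *ℤ (+ k +ℤ 1ℤ -ℤ + m -ℤ 1ℤ)) (closed (+ m) (+ d) (+ c))
      (trans (ℤₚ.pos-* 2 (24 * (2 + c))) (cong (+ 2 *ℤ_) (ℤₚ.pos-* 24 (2 + c))))
      binomQ-first
      (trans (cong (λ z → fromℤ (+ 2) *ℚ binomQ z) ℕtoℚ-shift) (binomQ-ℤ (+ k +ℤ 1ℤ -ℤ + m) 1≤k+1-m))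
      sum≡
      (subst (0ℤ ≤ℤ_) (sym (combination (+ m) (+ k) (+ c) (+ e₁ m) (+ e₂ m) (+ e₃ m) (+ Nk) (+ d) D≡))
        (0≤+ (0≤* (0≤* {+ 24} {+ 2 +ℤ + c} 0≤ℕ 0≤ℕ) (0≤-cast (N≤-lower m ≤-refl m≤k) lhs-cast rhs-cast))
          (0≤* {+ 2} 0≤ℕ (0≤+ (0≤+ (saving z≤n) (saving T≤N)) (saving ≤-refl)))))
      where
      saving : ∀ {t} (t≤N : t ≤ n C 2) → 0ℤ ≤ℤ slack (+ suc c) (+ d) (+ m) (+ At.edges t t≤N m)
      saving {t} t≤N = slack-nonneg d k 1≤d (At.edges t t≤N) (growth t t≤N) (suc c) m m≤k small

theorem5 : (m : ℕ) → 1 ≤ m → (Π : Halfperiod (3 * m)) → ThreeDecomposable m Π →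
    (k : ℕ) → 1 ≤ k → 2 * k < 3 * m → (s : ℕ) → IsS k (3 * m) s →
    Bound k (3 * m) s ≤ℚ ℕtoℚ (N≤ k Π)
theorem5 m 1≤m Π (_ , t , _ , _ , t+1≤N , _ , first≡B , _) k _ 2k<n s (_ , n≤) = bound (<-≤-connex k m)
  where
  -- At time t + 1 the order is B, C, A, so B comes first.
  T≤N : suc t ≤ (3 * m) C 2
  T≤N = ≤-trans (≤-reflexive (+-comm 1 t)) t+1≤N
  d : ℕ
  d = 3 * m ∸ (2 * k + 1)
  -- With d = 0 the upper inequality for `s` would read n ≤ 0.
  positive : ∀ c d → 3 * m ≤ c * (3 * d) → 1 ≤ d
  positive c (suc d) _ = s≤s z≤n
  positive c zero    h = ⊥-elim (<⇒≱ (≤-trans 1≤m (m≤m+n m (2 * m))) (≤-trans h (≤-reflexive (*-zeroʳ c))))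
  1≤d : 1 ≤ d
  1≤d = positive (suc s C 2) d n≤
  n≡ : 3 * m ≡ suc (k + (k + d))
  n≡ = trans (sym (m+[n∸m]≡n (≤-trans (≤-reflexive (+-comm (2 * k) 1)) 2k<n))) (collect k d)
    where
    collect : ∀ k d → 2 * k + 1 + d ≡ 1 + (k + (k + d))
    collect = ℕ-Ring.solve-∀
  bound : k < m ⊎ m ≤ k → Bound k (3 * m) s ≤ℚ ℕtoℚ (N≤ k Π)
  bound (inj₁ k<m) = bound-small m Π (suc t) T≤N first≡B k d 1≤d n≡ k<m s
  bound (inj₂ m≤k) = bound-large m Π (suc t) T≤N first≡B k d 1≤d n≡ m≤k s
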